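{- For every odd positive integer $k$, there exists an outer $k$-planar graph $G$ with treewidth $\operatorname{tw}(G) \geq 1.5k+0.5$.
   Context: Graphs are finite, simple and undirected. A convex drawing of a graph is a straight-line drawing in which the vertices are placed on distinct points of a circle. Given the resulting cyclic order $(v_1,\ldots,v_n)$ of the vertices, an edge $v_iv_j$ with $i<j$ crosses an edge $v_{i'}v_{j'}$ with $i'<j'$ if either $1\le i<i'<j<j'\le n$ or $1\le i'<i<j'<j\le n$. Only convex drawings in which no three pairwise non-adjacent edges pass through the same point are considered. An outer $k$-planar drawing is a convex drawing in which every edge crosses at most $k$ other edges; a graph is outer $k$-planar if it admits an outer $k$-planar drawing. Treewidth $\operatorname{tw}(G)$ is the minimum, over all tree decompositions of $G$, of the size of the largest bag minus one. -}

module Defs where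

open import Data.Fin using (Fin; _<_; _<?_)
open import Data.Fin.Permutation using (Permutation′; _⟨$⟩ʳ_)
open import Data.Fin.Subset using (Subset; _∈_; ∣_∣)
open import Data.Integer using (ℤ; _⊖_)
open import Data.List using (List; []; _∷_; _∷ʳ_; length; filter; allFin; cartesianProduct; tabulate)
open import Data.List.Extrema.Nat using (max)
open import Data.List.Relation.Unary.All using (All)
open import Data.List.Relation.Unary.Linked using (Linked)
open import Data.List.Relation.Unary.Unique.Propositional using (Unique)
open import Data.Nat as ℕ using (ℕ; NonZero)
open import Data.Product using (_×_; _,_; ∃)
open import Data.Rational as ℚ using (ℚ; 0ℚ; 1ℚ; _+_; _-_; _*_)
open import Data.Sum using (_⊎_)
open import Function.Definitions using (Injective)
open import Level using (0ℓ)
open import Relation.Binary.Construct.Closure.ReflexiveTransitive using (Star)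
open import Relation.Binary.Core using (Rel)
open import Relation.Binary.Definitions using (Decidable; Irreflexive; Symmetric)
open import Relation.Binary.PropositionalEquality using (_≡_)
open import Relation.Nullary using (¬_)
open import Relation.Nullary.Decidable using (_×-dec_; _⊎-dec_)

record Graph : Set₁ where
  infix 4 _~_ _~?_
  field
    order    : ℕ
    _~_      : Rel (Fin order) 0ℓ
    _~?_     : Decidable _~_
    ~-sym    : Symmetric _~_
    ~-irrefl : Irreflexive _≡_ _~_

  Vertex : Set
  Vertex = Fin order

-- Drawings have rational coordinates. Rational points are dense on a circle
-- with rational centre and radius, and moving the vertices of a real drawing
-- slightly changes neither their cyclic order nor the absence of triple
-- crossings, so the same graphs are outer k-planar as over the reals.

Point : Set
Point = ℚ × ℚ

distance² : Point → Point → ℚ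
distance² (x₁ , y₁) (x₂ , y₂) = (x₁ - x₂) * (x₁ - x₂) + (y₁ - y₂) * (y₁ - y₂)

-- Twice the signed area of the triangle; positive iff it is counterclockwise.
orientation : Point → Point → Point → ℚ
orientation (x₁ , y₁) (x₂ , y₂) (x₃ , y₃) =
  (x₂ - x₁) * (y₃ - y₁) - (y₂ - y₁) * (x₃ - x₁)

infix 4 _∈[_,_]

_∈[_,_] : Point → Point → Point → Set
(x , y) ∈[ (x₁ , y₁) , (x₂ , y₂) ] = ∃ λ t →
  0ℚ ℚ.≤ t × t ℚ.≤ 1ℚ ×
  x ≡ (1ℚ - t) * x₁ + t * x₂ ×
  y ≡ (1ℚ - t) * y₁ + t * y₂

record ConvexDrawing (G : Graph) : Set where
  open Graph G
  field
    position           : Vertex → Point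
    position-injective : Injective _≡_ _≡_ position
    centre             : Point
    radius             : ℚ
    radius>0           : 0ℚ ℚ.< radius
    on-circle          : ∀ u → distance² (position u) centre ≡ radius * radius
    cyclicOrder        : Permutation′ order

  v : Fin order → Vertex
  v i = cyclicOrder ⟨$⟩ʳ i

  -- Points of a circle are listed in counterclockwise cyclic order iff every
  -- three of them are.
  field
    counterclockwise : ∀ {i j l} → i < j → j < l →
      0ℚ ℚ.< orientation (position (v i)) (position (v j)) (position (v l))

  -- The pair (i , j), with i < j, stands for the edge between v i and v j, so
  -- every edge of G is listed once.
  edges : List (Fin order × Fin order)
  edges = filter (λ (i , j) → (i <? j) ×-dec (v i ~? v j))
                 (cartesianProduct (allFin order) (allFin order))

  Crosses : Rel (Fin order × Fin order) 0ℓ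
  Crosses (i , j) (i′ , j′) =
    (i < i′ × i′ < j × j < j′) ⊎ (i′ < i × i < j′ × j′ < j)

  crosses? : Decidable Crosses
  crosses? (i , j) (i′ , j′) =
    ((i <? i′) ×-dec (i′ <? j) ×-dec (j <? j′)) ⊎-dec
    ((i′ <? i) ×-dec (i <? j′) ×-dec (j′ <? j))

  crossings : Fin order × Fin order → ℕ
  crossings e = length (filter (crosses? e) edges)

  -- Three edges are pairwise non-adjacent iff their six ends are distinct. The
  -- common point of three such chords is rational if their ends are.
  NoTripleCrossing : Set
  NoTripleCrossing = ∀ {a b c d e f} → a ~ b → c ~ d → e ~ f →
    Unique (a ∷ b ∷ c ∷ d ∷ e ∷ f ∷ []) →
    ¬ ∃ λ p → p ∈[ position a , position b ] ×
              p ∈[ position c , position d ] ×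
              p ∈[ position e , position f ]

record IsOuterPlanarDrawing (k : ℕ) {G : Graph} (D : ConvexDrawing G) : Set where
  open ConvexDrawing D
  field
    noTripleCrossing : NoTripleCrossing
    fewCrossings     : All (λ e → crossings e ℕ.≤ k) edges

OuterPlanar : ℕ → Graph → Set
OuterPlanar k G = ∃ λ (D : ConvexDrawing G) → IsOuterPlanarDrawing k D

module _ (G : Graph) where
  open Graph G

  Connected : Set
  Connected = ∀ x y → Star _~_ x y

  IsCycle : Vertex → List Vertex → Set
  IsCycle x xs = 2 ℕ.≤ length xs × Unique (x ∷ xs) × Linked _~_ (x ∷ xs ∷ʳ x)

  record IsTree : Set where
    field
      nonEmpty  : NonZero order
      connected : Connected
      acyclic   : ∀ x xs → ¬ IsCycle x xs

record TreeDecomposition (G : Graph) : Set₁ where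
  open Graph G
  field
    tree   : Graph
    isTree : IsTree tree

  open Graph tree public using () renaming (Vertex to Node; _~_ to _~ᵀ_)

  field
    bag          : Node → Subset order
    coversVertex : ∀ u → ∃ λ t → u ∈ bag t
    coversEdge   : ∀ {u w} → u ~ w → ∃ λ t → u ∈ bag t × w ∈ bag t
    -- The nodes whose bags contain u induce a connected subgraph of the tree.
    subtree      : ∀ u {s t} → u ∈ bag s → u ∈ bag t →
      Star (λ a b → a ~ᵀ b × u ∈ bag a × u ∈ bag b) s t

  width : ℤ
  width = max 0 (tabulate (λ t → ∣ bag t ∣)) ⊖ 1

infix 4 _≤tw_

-- The treewidth is the least width, so it is at least q iff every width is.
_≤tw_ : ℚ → Graph → Set₁
q ≤tw G = (D : TreeDecomposition G) → q ℚ.≤ TreeDecomposition.width D ℚ./ 1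

-- Write k = 2m − 1. Cut a circle of 3N points into three blocks of N consecutive
-- points and join every point to its mirror image in its block; add the same
-- edges rotated by m points, and the path through all points. Chords of one
-- matching are nested or disjoint, and the partner of a point x in the other
-- matching lies on the same side of a chord unless x is among the 2m − 1 points
-- next to a fixed end of the chord, so every edge has at most k crossings.
--
-- Folding each block at its middle gives three ladders of width 2m, in which the
-- matchings form 3m disjoint lines, m between any two ladders. Lines between
-- ladders z and z + 1, each with a column of ladder z, form a bramble of
-- order 3m, so the treewidth is at least 3m − 1 = 1.5k + 0.5.
module Submission where

-- The oddness of k enters through k + 1 = 2m. Rotating by m moves the mirror of a block by m and so
-- changes the sum of two partners by 2m. Inside a block the two matchings compose to a translation
-- by 2m; cutting each half block into runs of 2m consecutive points therefore turns the matching
-- edges into 2m parallel lines. The path supplies the columns at no cost, because an edge between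
-- consecutive points crosses nothing.
--
-- Three ladders in a cycle suit the bramble because any two of them are equal or consecutive: of
-- two elements, the line of one always runs through the ladder that holds the column of the other.
-- Each ladder gets 3m columns, as many as there are lines, so that fewer than 3m vertices miss a
-- whole line and a column index at the same time.
--
-- A cyclic order alone does not give a drawing, since triple crossings must be excluded. The points
-- are placed so sparsely, with slopes in geometric progression, that no three chords with six
-- distinct ends concur, whatever the edges are.

open import Defs

-- Linear arithmetic over the naturals, by Farkas certificates

module LinearArithmetic where

  open import Data.Bool using (Bool; true; false; _∧_; if_then_else_; T)
  open import Data.Bool.Properties using (T-∧)
  open import Data.Empty using (⊥)
  open import Data.Fin using (Fin; zero; suc)
  open import Data.Integer as ℤ using (ℤ; 0ℤ; -1ℤ)
  open import Data.List using (List; []; _∷_; _++_; map; foldr; concatMap; filterᵇ; replicate; upTo;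
      drop; alignWith)
  open import Data.Nat
  open import Data.Nat.Properties
  open import Data.Nat.Tactic.RingSolver using (solve-∀)
  open import Data.Maybe as Maybe using (Maybe; just; nothing)
  open import Data.Product using (_×_; _,_; proj₁; proj₂; map₁; map₂)
  open import Data.These as These using ()
  open import Data.Unit using (⊤; tt)
  open import Data.Vec as Vec using (Vec; []; _∷_; zipWith; lookup)
  open import Data.Vec.N-ary using (N-ary; _$ⁿ_)
  open import Function using (id)
  open import Function.Bundles using (Equivalence)
  open import Relation.Binary.PropositionalEquality

  infixl 8 _:*_
  infixl 7 _:+_
  infix 6 _:≤_ _:<_ _:≡_

  data Term (n : ℕ) : Set where
    var  : Fin n → Term n
    con  : ℕ → Term n
    _:+_ : Term n → Term n → Term n
    _:*_ : ℕ → Term n → Term n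

  data Constraint (n : ℕ) : Set where
    _:≤_ _:<_ _:≡_ : Term n → Term n → Constraint n

  private variable
    n : ℕ

  ⟦_⟧ : Term n → Vec ℕ n → ℕ
  ⟦ var i ⟧ ρ = lookup ρ i
  ⟦ con c ⟧ ρ = c
  ⟦ s :+ t ⟧ ρ = ⟦ s ⟧ ρ + ⟦ t ⟧ ρ
  ⟦ c :* t ⟧ ρ = c * ⟦ t ⟧ ρ

  Holds : Constraint n → Vec ℕ n → Set
  Holds (s :≤ t) ρ = ⟦ s ⟧ ρ ≤ ⟦ t ⟧ ρ
  Holds (s :< t) ρ = ⟦ s ⟧ ρ < ⟦ t ⟧ ρ
  Holds (s :≡ t) ρ = ⟦ s ⟧ ρ ≡ ⟦ t ⟧ ρ

  -- The head of the vector is the constant coefficient.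
  Form : ℕ → Set
  Form n = Vec ℕ (suc n)

  -- Both sides of l ≤ r are kept, instead of l - r, so that all coefficients stay natural.
  Inequality : ℕ → Set
  Inequality n = Form n × Form n

  infix 9 _·_

  _·_ : Vec ℕ n → Vec ℕ n → ℕ
  []       · []       = 0
  (c ∷ cs) · (x ∷ xs) = c * x + cs · xs

  value : Form n → Vec ℕ n → ℕ
  value f ρ = f · (1 ∷ ρ)

  zeros : ∀ n → Vec ℕ n
  zeros n = Vec.replicate n 0

  unit : Fin n → Vec ℕ n
  unit zero    = 1 ∷ zeros _
  unit (suc i) = 0 ∷ unit i

  form : Term n → Form n
  form (var i)  = 0 ∷ unit i
  form (con c)  = c ∷ zeros _
  form (s :+ t) = zipWith _+_ (form s) (form t)
  form (c :* t) = Vec.map (c *_) (form t)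

  zeros-· : (xs : Vec ℕ n) → zeros n · xs ≡ 0
  zeros-· []       = refl
  zeros-· (x ∷ xs) = zeros-· xs

  unit-· : (i : Fin n) (xs : Vec ℕ n) → unit i · xs ≡ lookup xs i
  unit-· zero    (x ∷ xs) = trans (cong (x + 0 +_) (zeros-· xs)) (trans (+-identityʳ _)
      (+-identityʳ x))
  unit-· (suc i) (x ∷ xs) = unit-· i xs

  +-interchange : ∀ a b c d e → (a + b) * e + (c + d) ≡ (a * e + c) + (b * e + d)
  +-interchange = solve-∀

  ·-+ : (cs ds xs : Vec ℕ n) → zipWith _+_ cs ds · xs ≡ cs · xs + ds · xs
  ·-+ []       []       []       = refl
  ·-+ (c ∷ cs) (d ∷ ds) (x ∷ xs) =
    trans (cong ((c + d) * x +_) (·-+ cs ds xs)) (+-interchange c d (cs · xs) (ds · xs) x)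

  *-interchange : ∀ k c x d → k * c * x + k * d ≡ k * (c * x + d)
  *-interchange = solve-∀

  ·-* : ∀ k (cs xs : Vec ℕ n) → Vec.map (k *_) cs · xs ≡ k * (cs · xs)
  ·-* k []       []       = sym (*-zeroʳ k)
  ·-* k (c ∷ cs) (x ∷ xs) =
    trans (cong (k * c * x +_) (·-* k cs xs)) (*-interchange k c x (cs · xs))

  value-form : (t : Term n) (ρ : Vec ℕ n) → value (form t) ρ ≡ ⟦ t ⟧ ρ
  value-form (var i)  ρ = unit-· i ρ
  value-form (con c)  ρ = trans (cong (c * 1 +_) (zeros-· ρ)) (trans (+-identityʳ _)
      (*-identityʳ c))
  value-form (s :+ t) ρ = trans (·-+ (form s) (form t) (1 ∷ ρ)) (cong₂ _+_ (value-form s ρ)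
      (value-form t ρ))
  value-form (c :* t) ρ = trans (·-* c (form t) (1 ∷ ρ)) (cong (c *_) (value-form t ρ))

  Satisfied : Vec ℕ n → Inequality n → Set
  Satisfied ρ (l , r) = value l ρ ≤ value r ρ

  inequality : Term n → Term n → Inequality n
  inequality s t = form s , form t

  inequalities : List (Constraint n) → List (Inequality n)
  inequalities []              = []
  inequalities (s :≤ t ∷ cs) = inequality s t ∷ inequalities cs
  inequalities (s :< t ∷ cs) = inequality (con 1 :+ s) t ∷ inequalities cs
  inequalities (s :≡ t ∷ cs) = inequality s t ∷ inequality t s ∷ inequalities cs

  combination : List (Inequality n) → List ℕ → Inequality n
  combination ((l , r) ∷ is) (c ∷ cs) =
    zipWith _+_ (Vec.map (c *_) l) (proj₁ (combination is cs)) , zipWith _+_ (Vec.map (c *_) r)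
        (proj₂ (combination is cs))
  -- A list of multipliers that is too short counts as padded with zeros; the search does return
  -- such lists.
  combination _ _ = zeros _ , zeros _

  _≥ᵛ_ : Vec ℕ n → Vec ℕ n → Bool
  []       ≥ᵛ []       = true
  (c ∷ cs) ≥ᵛ (d ∷ ds) = (d ≤ᵇ c) ∧ (cs ≥ᵛ ds)

  -- On the left the constant is larger and no coefficient is smaller, so the left side exceeds the
  -- right one for all natural values of the variables.
  contradictory : Inequality n → Bool
  contradictory (c ∷ cs , d ∷ ds) = (d <ᵇ c) ∧ (cs ≥ᵛ ds)

  ≥ᵛ-sound : (cs ds xs : Vec ℕ n) → T (cs ≥ᵛ ds) → ds · xs ≤ cs · xs
  ≥ᵛ-sound []       []       []       _ = z≤n
  ≥ᵛ-sound (c ∷ cs) (d ∷ ds) (x ∷ xs) h =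
    +-mono-≤ (*-monoˡ-≤ x (≤ᵇ⇒≤ d c (proj₁ (Equivalence.to T-∧ h)))) (≥ᵛ-sound cs ds xs
        (proj₂ (Equivalence.to (T-∧ {d ≤ᵇ c}) h)))

  contradictory-sound : (ρ : Vec ℕ n) (i : Inequality n) → T (contradictory i) → Satisfied ρ i → ⊥
  contradictory-sound ρ (c ∷ cs , d ∷ ds) h s = <⇒≱
    (+-mono-<-≤ (*-monoˡ-< 1 (<ᵇ⇒< d c (proj₁ (Equivalence.to T-∧ h)))) (≥ᵛ-sound cs ds ρ
        (proj₂ (Equivalence.to (T-∧ {d <ᵇ c}) h)))) s

  AllHold : List (Constraint n) → Vec ℕ n → Set
  AllHold cs ρ = foldr (λ c → Holds c ρ ×_) ⊤ cs

  AllSatisfied : Vec ℕ n → List (Inequality n) → Set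
  AllSatisfied ρ is = foldr (λ i → Satisfied ρ i ×_) ⊤ is

  inequality-sound : ∀ s t {ρ : Vec ℕ n} → ⟦ s ⟧ ρ ≤ ⟦ t ⟧ ρ → Satisfied ρ (inequality s t)
  inequality-sound s t {ρ} = subst₂ _≤_ (sym (value-form s ρ)) (sym (value-form t ρ))

  inequalities-sound : ∀ cs {ρ : Vec ℕ n} → AllHold cs ρ → AllSatisfied ρ (inequalities cs)
  inequalities-sound []              _        = tt
  inequalities-sound (s :≤ t ∷ cs) (h , hs) = inequality-sound s t h , inequalities-sound cs hs
  inequalities-sound (s :< t ∷ cs) (h , hs) = inequality-sound (con 1 :+ s) t h ,
      inequalities-sound cs hs
  inequalities-sound (s :≡ t ∷ cs) (h , hs) =
    inequality-sound s t (≤-reflexive h) , inequality-sound t s (≤-reflexive (sym h)) ,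
        inequalities-sound cs hs

  combination-sound : ∀ (ρ : Vec ℕ n) is cs → AllSatisfied ρ is → Satisfied ρ (combination is cs)
  combination-sound ρ []             cs       _        = ≤-refl
  combination-sound ρ (i ∷ is)       []       _        = ≤-refl
  combination-sound ρ ((l , r) ∷ is) (c ∷ cs) (s , ss) = subst₂ _≤_
    (sym (trans (·-+ (Vec.map (c *_) l) _ (1 ∷ ρ)) (cong (_+ value (proj₁ (combination is cs)) ρ)
        (·-* c l (1 ∷ ρ)))))
    (sym (trans (·-+ (Vec.map (c *_) r) _ (1 ∷ ρ)) (cong (_+ value (proj₂ (combination is cs)) ρ)
        (·-* c r (1 ∷ ρ)))))
    (+-mono-≤ (*-monoʳ-≤ c s) (combination-sound ρ is cs ss))

  -- Fourier–Motzkin elimination. A row pairs multipliers of the given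
  -- inequalities l ≤ r with the coefficients of the resulting l − r ≤ 0. Only the
  -- multipliers it finds matter, since they are checked by `contradictory`.

  Row : Set
  Row = List ℕ × List ℤ

  at : ℕ → List ℤ → ℤ
  at k xs with drop k xs
  ... | []    = 0ℤ
  ... | x ∷ _ = x

  isPositive isNegative isZero : ℤ → Bool
  isPositive (ℤ.+ suc _)  = true
  isPositive _            = false
  isNegative ℤ.-[1+ _ ]   = true
  isNegative _            = false
  isZero (ℤ.+ zero)       = true
  isZero _                = false

  scale : ℕ → Row → Row
  scale c (ms , xs) = map (c *_) ms , map (ℤ.+ c ℤ.*_) xs

  -- Meant for rows with opposite signs in column `k`: scaling each by the absolute coefficient of
  -- the other makes that column vanish with non-negative multipliers.
  cancel : ℕ → Row → Row → Row
  cancel k p q with scale ℤ.∣ at k (proj₂ q) ∣ p | scale ℤ.∣ at k (proj₂ p) ∣ q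
  ... | ms , xs | ns , ys = alignWith (These.fold id id _+_) ms ns ,
        alignWith (These.fold id id ℤ._+_) xs ys

  eliminate : ℕ → List Row → List Row
  eliminate k rows =
    concatMap (λ p → map (cancel k p) (filterᵇ (λ r → isNegative (at k (proj₂ r))) rows))
              (filterᵇ (λ r → isPositive (at k (proj₂ r))) rows)
    ++ filterᵇ (λ r → isZero (at k (proj₂ r))) rows

  findPivot : ℕ → List (Row × Row) → Maybe ((Row × Row) × List (Row × Row))
  findPivot k [] = nothing
  findPivot k (e ∷ es) =
    if isZero (at k (proj₂ (proj₁ e))) then Maybe.map (map₂ (e ∷_)) (findPivot k es) else just (e ,
        es)

  -- An equation is a pair of opposite rows. As multipliers must not become negative, the row of the
  -- pair is chosen whose sign in column `k` is opposite to that of `r`.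
  substitute : ℕ → Row × Row → Row → Row
  substitute k (e , e′) r =
    if isZero (at k (proj₂ r)) then r
    else if isPositive (at k (proj₂ r) ℤ.* at k (proj₂ e)) then cancel k r e′ else cancel k r e

  System : Set
  System = List (Row × Row) × List Row

  -- Substituting from an equation keeps the number of rows down, so pairing of positive with
  -- negative rows is left to the variables that occur in no equation.
  step : ℕ → System → System
  step k (es , rs) with findPivot k es
  ... | just (p , es′) = map (λ (e , e′) → substitute k p e , substitute k p e′) es′ ,
        map (substitute k p) rs
  ... | nothing        = es , eliminate k rs

  difference : Term n → Term n → List ℤ
  difference s t = Vec.toList (zipWith ℤ._⊖_ (form s) (form t))

  indicator : ℕ → List ℕ
  indicator k = replicate k 0 ++ 1 ∷ []

  system : ℕ → List (Constraint n) → System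
  system k []              = [] , []
  system k (s :≤ t ∷ cs) = map₂ ((indicator k , difference s t) ∷_) (system (suc k) cs)
  system k (s :< t ∷ cs) = map₂ ((indicator k , difference (con 1 :+ s) t) ∷_) (system (suc k) cs)
  -- An equation yields two entries of `inequalities`, so the positions of the multipliers advance
  -- by 2.
  system k (s :≡ t ∷ cs) =
    map₁ (((indicator k , difference s t) , (indicator (suc k) , difference t s)) ∷_)
        (system (2 + k) cs)

  -- The row -x ≤ 0 of a variable. It carries no multiplier, because `contradictory` accounts for it
  -- by comparing coefficients.
  nonNegative : ℕ → Row
  nonNegative k = [] , replicate (suc k) 0ℤ ++ -1ℤ ∷ []

  multipliers : ∀ n → List (Constraint n) → List ℕ
  multipliers n cs with foldr step (map₂ (map nonNegative (upTo n) ++_) (system 0 cs))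
      (map suc (upTo n))
  -- All variables are eliminated by now, so a row with a positive constant c reads c ≤ 0, and its
  -- multipliers are the certificate.
  ... | es , rs with filterᵇ (λ r → isPositive (at 0 (proj₂ r))) (concatMap (λ (e , e′) → e ∷ e′ ∷
        []) es ++ rs)
  ... | []          = []
  ... | (ms , _) ∷ _ = ms

  inconsistent : List (Constraint n) → Bool
  inconsistent {n} cs = contradictory (combination (inequalities cs) (multipliers n cs))

  inconsistent-sound : ∀ cs → T (inconsistent cs) → (ρ : Vec ℕ n) → AllHold cs ρ → ⊥
  inconsistent-sound {n} cs h ρ hs = contradictory-sound ρ (combination (inequalities cs) ms) h
    (combination-sound ρ (inequalities cs) ms (inequalities-sound cs hs))
    where ms = multipliers n cs

  infix 3 _⊢_

  record Entailment (n : ℕ) : Set where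
    constructor _⊢_
    field
      hypotheses : List (Constraint n)
      conclusion : Constraint n

  valid : Entailment n → Bool
  valid (cs ⊢ s :≤ t) = inconsistent (t :< s ∷ cs)
  valid (cs ⊢ s :< t) = inconsistent (t :≤ s ∷ cs)
  valid (cs ⊢ s :≡ t) = inconsistent (s :< t ∷ cs) ∧ inconsistent (t :< s ∷ cs)

  valid-sound : ∀ cs c → T (valid (cs ⊢ c)) → (ρ : Vec ℕ n) → AllHold cs ρ → Holds c ρ
  valid-sound cs (s :≤ t) h ρ hs = ≮⇒≥ λ t<s → inconsistent-sound (t :< s ∷ cs) h ρ (t<s , hs)
  valid-sound cs (s :< t) h ρ hs = ≰⇒> λ t≤s → inconsistent-sound (t :≤ s ∷ cs) h ρ (t≤s , hs)
  valid-sound cs (s :≡ t) h ρ hs = ≤-antisym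
    (≮⇒≥ λ t<s → inconsistent-sound (t :< s ∷
        cs) (proj₂ (Equivalence.to (T-∧ {inconsistent (s :< t ∷ cs)}) h)) ρ (t<s , hs))
    (≮⇒≥ λ s<t → inconsistent-sound (s :< t ∷ cs) (proj₁ (Equivalence.to T-∧ h)) ρ (s<t , hs))

  ForAll : ∀ n → (Vec ℕ n → Set) → Set
  ForAll zero    P = P []
  ForAll (suc n) P = ∀ x → ForAll n (λ xs → P (x ∷ xs))

  forAll : ∀ n {P : Vec ℕ n → Set} → (∀ xs → P xs) → ForAll n P
  forAll zero    f = f []
  forAll (suc n) f x = forAll n (λ xs → f (x ∷ xs))

  Implies : List (Constraint n) → Set → Vec ℕ n → Set
  Implies []       A ρ = A
  Implies (c ∷ cs) A ρ = Holds c ρ → Implies cs A ρ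

  implies : ∀ cs {A} {ρ : Vec ℕ n} → (AllHold cs ρ → A) → Implies cs A ρ
  implies []       f = f tt
  implies (c ∷ cs) f h = implies cs (λ hs → f (h , hs))

  instantiate : ∀ {A : Set} n → N-ary n (Term n) A → A
  instantiate n f = f $ⁿ Vec.map var (Vec.allFin n)

  -- The type of the implicit argument computes to the unit type when the search succeeds, so it is
  -- filled in during type checking. The conclusion is curried over the values and the hypotheses.
  refute : ∀ n (f : N-ary n (Term n) (List (Constraint n))) →
           {_ : T (inconsistent (instantiate n f))} →
           ForAll n (Implies (instantiate n f) ⊥)
  refute n f {h} = forAll n (λ ρ → implies cs (inconsistent-sound cs h ρ))
    where cs = instantiate n f

  derive : ∀ n (f : N-ary n (Term n) (Entailment n)) → let open Entailment (instantiate n f) in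
           {_ : T (valid (instantiate n f))} →
           ForAll n (λ ρ → Implies hypotheses (Holds conclusion ρ) ρ)
  derive n f {h} = forAll n (λ ρ → implies hypotheses (valid-sound hypotheses conclusion h ρ))
    where open Entailment (instantiate n f)

-- Rational points of a circle without triple crossings

module Geometry where

  open import Data.Empty using (⊥)
  open import Data.Fin using (Fin; toℕ)
  import Data.Fin.Permutation as Permutation
  open import Data.Fin.Properties using (toℕ-injective)
  open import Data.List.Relation.Unary.All using ([]; _∷_)
  open import Data.List.Relation.Unary.AllPairs using ([]; _∷_)
  open import Data.Nat as ℕ using (ℕ; zero; suc)
  import Data.Nat.Properties as ℕ
  open import Data.Product using (_×_; _,_; proj₁; proj₂; ∃)
  open import Data.Rational
  open import Data.Rational.Properties
  open import Data.Rational.Solver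
  open import Data.Sum using (_⊎_; inj₁; inj₂)
  open import Function using (_∘_)
  open import Relation.Binary.Definitions using (tri<; tri≈; tri>)
  open import Relation.Binary.PropositionalEquality
  open import Relation.Nullary
  open +-*-Solver using (solve; _:+_; _:*_; _:-_; :-_; _:=_; con)

  *-pos : ∀ {p q} → 0ℚ < p → 0ℚ < q → 0ℚ < p * q
  *-pos {p} {q} 0<p 0<q = positive⁻¹ (p * q) ⦃ pos*pos⇒pos p ⦃ positive 0<p ⦄ q ⦃ positive 0<q ⦄ ⦄

  *-nonNeg : ∀ {p q} → 0ℚ ≤ p → 0ℚ ≤ q → 0ℚ ≤ p * q
  *-nonNeg {p} {q} 0≤p 0≤q = nonNegative⁻¹ (p * q) ⦃ nonNeg*nonNeg⇒nonNeg p ⦃ nonNegative 0≤p ⦄ q ⦃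
      nonNegative 0≤q ⦄ ⦄

  +-pos : ∀ {p q} → 0ℚ < p → 0ℚ < q → 0ℚ < p + q
  +-pos = +-mono-<

  +-pos-nonNeg : ∀ {p q} → 0ℚ < p → 0ℚ ≤ q → 0ℚ < p + q
  +-pos-nonNeg = +-mono-<-≤

  <⇒0<- : ∀ {p q} → p < q → 0ℚ < q - p
  <⇒0<- {p} {q} p<q = subst (_< q - p) (+-inverseʳ p) (+-monoˡ-< (- p) p<q)

  ≤⇒0≤- : ∀ {p q} → p ≤ q → 0ℚ ≤ q - p
  ≤⇒0≤- {p} {q} p≤q = subst (_≤ q - p) (+-inverseʳ p) (+-monoˡ-≤ (- p) p≤q)

  square-nonNeg : ∀ p → 0ℚ ≤ p * p
  square-nonNeg p with ≤-total 0ℚ p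
  ... | inj₁ 0≤p = *-nonNeg 0≤p 0≤p
  ... | inj₂ p≤0 = subst (0ℚ ≤_) (solve 1 (λ p → (con 0ℚ :- p) :* (con 0ℚ :- p)
        := p :* p) refl p) (*-nonNeg (≤⇒0≤- p≤0) (≤⇒0≤- p≤0))

  0<-⇒< : ∀ {p q} → 0ℚ < q - p → p < q
  0<-⇒< {p} {q} h = subst₂ _<_ (+-identityˡ p) (solve 2 (λ p q → q :- p :+ p
      := q) refl p q) (+-monoˡ-< p h)

  p*q≡0⇒p≡0⊎q≡0 : ∀ {p q} → p * q ≡ 0ℚ → p ≡ 0ℚ ⊎ q ≡ 0ℚ
  p*q≡0⇒p≡0⊎q≡0 {p} {q} e with p ≟ 0ℚ
  ... | yes p≡0 = inj₁ p≡0
  ... | no  p≢0 = inj₂ (begin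
    q                       ≡⟨ *-identityˡ q ⟨
    1ℚ * q                  ≡⟨ cong (_* q) (*-inverseˡ p) ⟨
    1/ p * p * q            ≡⟨ *-assoc (1/ p) p q ⟩
    1/ p * (p * q)          ≡⟨ cong (1/ p *_) e ⟩
    1/ p * 0ℚ               ≡⟨ *-zeroʳ (1/ p) ⟩
    0ℚ                      ∎)
    where
    open ≡-Reasoning
    instance _ = ≢-nonZero p≢0

  0<1 : 0ℚ < 1ℚ
  0<1 = positive⁻¹ 1ℚ

  power : ℕ → ℚ
  power zero    = 1ℚ
  power (suc i) = power i + power i

  power>0 : ∀ i → 0ℚ < power i
  power>0 zero    = 0<1
  power>0 (suc i) = +-pos (power>0 i) (power>0 i)

  power-mono-≤ : ∀ {i j} → i ℕ.≤ j → power i ≤ power j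
  power-mono-≤ {j = j} ℕ.z≤n = one≤ j
    where
    one≤ : ∀ j → 1ℚ ≤ power j
    one≤ zero    = ≤-refl
    one≤ (suc j) = ≤-trans (one≤ j) (subst (_≤ power j + power j) (+-identityʳ (power j))
        (+-monoʳ-≤ (power j) (<⇒≤ (power>0 j))))
  power-mono-≤ (ℕ.s≤s i≤j) = +-mono-≤ (power-mono-≤ i≤j) (power-mono-≤ i≤j)

  power-doubles : ∀ {i j} → i ℕ.< j → power i + power i ≤ power j
  power-doubles = power-mono-≤

  power-mono-< : ∀ {i j} → i ℕ.< j → power i < power j
  power-mono-< {i} {j} i<j = <-≤-trans (subst (_< power i + power i) (+-identityʳ (power i))
      (+-monoʳ-< (power i) (power>0 i))) (power-doubles i<j)

  -- The line of slope s through the origin meets the circle with diameter from (0 , 0) to (1 , 0)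
  -- again at (w , s w), w = 1 / (1 + s²). Rational slopes thus give rational points.
  circle-equation : ∀ s w → w * (1ℚ + s * s) ≡ 1ℚ → distance² (w , s * w) (½ , 0ℚ) ≡ ½ * ½
  circle-equation s w inverse = begin
    (w - ½) * (w - ½) + (s * w - 0ℚ) * (s * w - 0ℚ)
      ≡⟨ solve 2 (λ s w →
           (w :- con ½) :* (w :- con ½) :+ (s :* w :- con 0ℚ) :* (s :* w :- con 0ℚ)
           := w :* (w :* (con 1ℚ :+ s :* s)) :- w :+ con ½ :* con ½) refl s w ⟩
    w * (w * (1ℚ + s * s)) - w + ½ * ½
      ≡⟨ cong (λ u → w * u - w + ½ * ½) inverse ⟩
    w * 1ℚ - w + ½ * ½
      ≡⟨ solve 1 (λ w → w :* con 1ℚ :- w :+ con ½ :* con ½ := con ½ :* con ½) refl w ⟩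
    ½ * ½ ∎
    where open ≡-Reasoning

  -- Since 1 = u (1 + a²), the row (u , a u , 1) of the orientation determinant is u (1 , a , 1 +
  -- a²), which leaves a Vandermonde determinant. The factors `1ℚ` below mark where the three weight
  -- equations are inserted.
  orientation-circle : ∀ a b c u v w → u * (1ℚ + a * a) ≡ 1ℚ → v * (1ℚ + b * b) ≡ 1ℚ →
      w * (1ℚ + c * c) ≡ 1ℚ →
    orientation (u , a * u) (v , b * v) (w , c * w) ≡ (b - a) * (c - a) * (c - b) * (u * v * w)
  orientation-circle a b c u v w eu ev ew = begin
    (v - u) * (c * w - a * u) - (b * v - a * u) * (w - u)
      ≡⟨ solve 6 (λ a b c u v w → (v :- u) :* (c :* w :- a :* u) :- (b :* v :- a :* u) :* (w :- u)
           := v :* w :* (c :- b) :* con 1ℚ :+ u :* w :* (a :- c) :* con 1ℚ :+ u :* v :* (b :- a)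
               :* con 1ℚ) refl a b c u v w ⟩
    v * w * (c - b) * 1ℚ + u * w * (a - c) * 1ℚ + u * v * (b - a) * 1ℚ
      ≡⟨ cong₂ _+_ (cong₂ (λ p q → v * w * (c - b) * p + u * w * (a - c) * q) eu ev)
          (cong (u * v * (b - a) *_) ew) ⟨
    v * w * (c - b) * (u * (1ℚ + a * a)) + u * w * (a - c) * (v * (1ℚ + b * b)) + u * v * (b - a) *
        (w * (1ℚ + c * c))
      ≡⟨ solve 6 (λ a b c u v w → v :* w :* (c :- b) :* (u :* (con 1ℚ :+ a :* a)) :+ u :* w :*
          (a :- c) :* (v :* (con 1ℚ :+ b :* b)) :+ u :* v :* (b :- a) :* (w :* (con 1ℚ :+ c :* c))
           := (b :- a) :* (c :- a) :* (c :- b) :* (u :* v :* w)) refl a b c u v w ⟩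
    (b - a) * (c - a) * (c - b) * (u * v * w) ∎
    where open ≡-Reasoning

  module Chord (s t u v : ℚ) (es : u * (1ℚ + s * s) ≡ 1ℚ) (et : v * (1ℚ + t * t) ≡ 1ℚ)
      (0<u : 0ℚ < u) (0<v : 0ℚ < v)
               (x y : ℚ) (on : (x , y) ∈[ (u , s * u) , (v , t * v) ]) where

    τ = proj₁ on
    0≤τ = proj₁ (proj₂ on)
    τ≤1 = proj₁ (proj₂ (proj₂ on))
    x≡ = proj₁ (proj₂ (proj₂ (proj₂ on)))
    y≡ = proj₂ (proj₂ (proj₂ (proj₂ on)))

    0≤1-τ : 0ℚ ≤ 1ℚ - τ
    0≤1-τ = ≤⇒0≤- τ≤1

    x>0 : 0ℚ < x
    x>0 with τ ≟ 1ℚ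
    ... | yes refl =
          subst (0ℚ <_) (sym (trans x≡ (solve 2 (λ u v → (con 1ℚ :- con 1ℚ) :* u :+ con 1ℚ :* v
          := v) refl u v))) 0<v
    ... | no  τ≢1 = subst (0ℚ <_) (sym x≡) (+-pos-nonNeg (*-pos (<⇒0<- (≤∧≢⇒< τ≤1 τ≢1)) 0<u)
          (*-nonNeg 0≤τ (<⇒≤ 0<v)))
      where
      ≤∧≢⇒< : ∀ {p q} → p ≤ q → p ≢ q → p < q
      ≤∧≢⇒< {p} {q} p≤q p≢q with <-cmp p q
      ... | tri< p<q _ _ = p<q
      ... | tri≈ _ p≡q _ = contradiction p≡q p≢q
      ... | tri> _ _ q<p = contradiction (<-≤-trans q<p p≤q) (<-irrefl refl)

    -- The equation of the chord: an affine expression that at an end equals 1 - u (1 + s²) or 1 - v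
    -- (1 + t²), hence vanishes at both.
    line : s * t * x - (s + t) * y + 1ℚ - x ≡ 0ℚ
    line = begin
      s * t * x - (s + t) * y + 1ℚ - x
        ≡⟨ cong₂ (λ x y → s * t * x - (s + t) * y + 1ℚ - x) x≡ y≡ ⟩
      s * t * ((1ℚ - τ) * u + τ * v) - (s + t) * ((1ℚ - τ) * (s * u) + τ * (t * v)) + 1ℚ -
          ((1ℚ - τ) * u + τ * v)
        ≡⟨ solve 5 (λ s t u v τ → s :* t :* ((con 1ℚ :- τ) :* u :+ τ :* v) :- (s :+ t) :*
            ((con 1ℚ :- τ) :* (s :* u) :+ τ :* (t :* v)) :+ con 1ℚ :- ((con 1ℚ :- τ) :* u :+ τ :* v)
             := (con 1ℚ :- τ) :* (con 1ℚ :- u :* (con 1ℚ :+ s :* s)) :+ τ :* (con 1ℚ :- v :*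
                 (con 1ℚ :+ t :* t))) refl s t u v τ ⟩
      (1ℚ - τ) * (1ℚ - u * (1ℚ + s * s)) + τ * (1ℚ - v * (1ℚ + t * t))
        ≡⟨ cong₂ (λ p q → (1ℚ - τ) * (1ℚ - p) + τ * (1ℚ - q)) es et ⟩
      (1ℚ - τ) * (1ℚ - 1ℚ) + τ * (1ℚ - 1ℚ)
        ≡⟨ solve 1 (λ τ → (con 1ℚ :- τ) :* (con 1ℚ :- con 1ℚ) :+ τ :* (con 1ℚ :- con 1ℚ)
            := con 0ℚ) refl τ ⟩
      0ℚ ∎
      where open ≡-Reasoning

    -- The right-hand side does not depend on the chord.
    product : (x * s - y) * (x * t - y) ≡ x * x + y * y - x
    product = begin
      (x * s - y) * (x * t - y)
        ≡⟨ solve 4 (λ s t x y → (x :* s :- y) :* (x :* t :- y)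
            := x :* (s :* t :* x :- (s :+ t) :* y :+ con 1ℚ :- x) :+ (x :* x :+ y :* y :- x))
            refl s t x y ⟩
      x * (s * t * x - (s + t) * y + 1ℚ - x) + (x * x + y * y - x)
        ≡⟨ cong (λ z → x * z + (x * x + y * y - x)) line ⟩
      x * 0ℚ + (x * x + y * y - x)
        ≡⟨ solve 2 (λ x y → x :* con 0ℚ :+ (x :* x :+ y :* y :- x)
            := x :* x :+ y :* y :- x) refl x y ⟩
      x * x + y * y - x ∎
      where open ≡-Reasoning

    -- The product is the power of the point with respect to the circle, and a chord lies in the
    -- disc: explicitly, minus the product is τ (1 - τ) u v (s - t)².
    product≤0 : 0ℚ ≤ - ((x * s - y) * (x * t - y))
    product≤0 = subst (0ℚ ≤_) (sym (trans (cong₂ (λ x y → - ((x * s - y) * (x * t - y))) x≡ y≡)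
      (solve 5 (λ s t u v τ →
          :- ((((con 1ℚ :- τ) :* u :+ τ :* v) :* s :- ((con 1ℚ :- τ) :* (s :* u) :+ τ :* (t :* v)))
                                 :* (((con 1ℚ :- τ) :* u :+ τ :* v) :* t :- ((con 1ℚ :- τ) :*
                                     (s :* u) :+ τ :* (t :* v))))
          := (τ :* v) :* ((con 1ℚ :- τ) :* u) :* ((s :- t) :* (s :- t))) refl s t u v τ)))
      (*-nonNeg (*-nonNeg (*-nonNeg 0≤τ (<⇒≤ 0<v)) (*-nonNeg 0≤1-τ (<⇒≤ 0<u)))
          (square-nonNeg (s - t)))

  -- Three chords through one point

  module Concurrent (x y : ℚ) (0<x : 0ℚ < x) where

    -- By `product`, a chord through (x , y) with ends i and j has `f i * f j` equal to the power of
    -- that point, so concurrent chords give equal products.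
    f : ℕ → ℚ
    f i = x * power i - y

    f-mono-≤ : ∀ {i j} → i ℕ.≤ j → 0ℚ ≤ f j - f i
    f-mono-≤ {i} {j} i≤j = subst (0ℚ ≤_) (solve 4 (λ x y a b → x :* (b :- a)
        := (x :* b :- y) :- (x :* a :- y)) refl x y (power i) (power j))
      (*-nonNeg (<⇒≤ 0<x) (≤⇒0≤- (power-mono-≤ i≤j)))

    f-mono-< : ∀ {i j} → i ℕ.< j → f i < f j
    f-mono-< {i} {j} i<j = 0<-⇒< (subst (0ℚ <_) (solve 4 (λ x y a b → x :* (b :- a)
        := (x :* b :- y) :- (x :* a :- y)) refl x y (power i) (power j))
      (*-pos 0<x (<⇒0<- (power-mono-< i<j))))

    f-injective : ∀ {i j} → f i ≡ f j → i ≡ j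
    f-injective {i} {j} e with ℕ.<-cmp i j
    ... | tri< i<j _ _ = contradiction e (<⇒≢ (f-mono-< i<j))
    ... | tri≈ _ i≡j _ = i≡j
    ... | tri> _ _ j<i = contradiction (sym e) (<⇒≢ (f-mono-< j<i))

    -- The slopes double at each index, so j < l alone gives `power l` ≥ 2 `power j`, and `power i`
    -- > 0 makes the inequality strict.
    f-convex : ∀ {i j l} → j ℕ.< l → 0ℚ < f i + f l - (f j + f j)
    f-convex {i} {j} {l} j<l = subst (0ℚ <_)
      (solve 5 (λ x y a b c → x :* (a :+ (c :- (b :+ b)))
          := (x :* a :- y) :+ (x :* c :- y) :- ((x :* b :- y) :+ (x :* b :- y))) refl x y (power i)
          (power j) (power l))
      (*-pos 0<x (+-pos-nonNeg (power>0 i) (≤⇒0≤- (power-doubles j<l))))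

    0<neg : ∀ {p} → p < 0ℚ → 0ℚ < - p
    0<neg {p} p<0 = subst (0ℚ <_) (+-identityˡ (- p)) (<⇒0<- p<0)

    module _ {e : ℚ} where

      Partner : ℕ → Set
      Partner n = ∃ λ p → f n < 0ℚ × 0ℚ < f p × f n * f p ≡ e

      private
        0≢pos : ∀ {p q r} → 0ℚ < r → r ≡ p - q → p ≢ q
        0≢pos {p} 0<r r≡ refl = <-irrefl (sym (trans r≡ (+-inverseʳ p))) 0<r

      -- If p₂ ≤ p₁, then passing from n₂, p₂ to n₁, p₁ strictly increases the absolute value of the
      -- negative factor without decreasing the positive one, so the products differ.
      partner-mono : ∀ {n₁ n₂ p₁ p₂} → n₁ ℕ.< n₂ → f n₂ < 0ℚ → 0ℚ < f p₁ →
          f n₁ * f p₁ ≡ f n₂ * f p₂ → p₁ ℕ.< p₂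
      partner-mono {n₁} {n₂} {p₁} {p₂} n₁<n₂ n₂<0 0<p₁ same = ℕ.≰⇒> λ p₂≤p₁ → 0≢pos
        (+-pos-nonNeg (*-pos (<⇒0<- (f-mono-< n₁<n₂)) 0<p₁) (*-nonNeg (<⇒≤ (0<neg n₂<0))
            (f-mono-≤ p₂≤p₁)))
        (solve 4 (λ a b c d → (b :- a) :* c :+ (:- b) :* (c :- d)
            := b :* d :- a :* c) refl (f n₁) (f n₂) (f p₁) (f p₂))
        (sym same)

      -- By convexity the gaps between the values of f grow, so |f n₁| < 2 |f n₂|
      -- and f p₂ > 2 f p₁ > 0, contradicting f n₁ f p₁ = f n₂ f p₂.
      three-partners : ∀ {n₁ n₂ n₃} → n₁ ℕ.< n₂ → n₂ ℕ.< n₃ → Partner n₁ → Partner n₂ → Partner n₃ →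
          ⊥
      three-partners {n₁} {n₂} {n₃} n₁<n₂ n₂<n₃ (p₁ , n₁<0 , 0<p₁ , e₁) (p₂ , n₂<0 , 0<p₂ ,
          e₂) (p₃ , n₃<0 , 0<p₃ , e₃) =
        0≢pos (+-pos (+-pos (*-pos a₂ a₃) (*-pos a₂ (f-convex {n₃} p₁<p₂))) (+-pos (*-pos a₃ 0<p₁)
            (*-pos (f-convex {n₁} n₂<n₃) 0<p₁)))
        (solve 5 (λ a b c v w → (:- b) :* (:- c) :+ (:- b) :* (c :+ w :- (v :+ v)) :+
            ((:- c) :* v :+ (a :+ c :- (b :+ b)) :* v)
           := a :* v :- b :* w) refl (f n₁) (f n₂) (f n₃) (f p₁) (f p₂)) same
        where
        same = trans e₁ (sym e₂)
        a₂ = 0<neg n₂<0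
        a₃ = 0<neg n₃<0
        p₁<p₂ = partner-mono {n₁} {n₂} {p₁} {p₂} n₁<n₂ n₂<0 0<p₁ same

      three-distinct-partners : ∀ {a b c} → a ≢ b → a ≢ c → b ≢ c → Partner a → Partner b →
          Partner c → ⊥
      three-distinct-partners {a} {b} {c} a≢b a≢c b≢c A B C
          with ℕ.<-cmp a b | ℕ.<-cmp b c | ℕ.<-cmp a c
      ... | tri≈ _ a≡b _ | _ | _ = a≢b a≡b
      ... | _ | tri≈ _ b≡c _ | _ = b≢c b≡c
      ... | _ | _ | tri≈ _ a≡c _ = a≢c a≡c
      ... | tri< a<b _ _ | tri< b<c _ _ | _            = three-partners a<b b<c A B C
      ... | tri< a<b _ _ | tri> _ _ c<b | tri< a<c _ _ = three-partners a<c c<b A C B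
      ... | tri< a<b _ _ | tri> _ _ c<b | tri> _ _ c<a = three-partners c<a a<b C A B
      ... | tri> _ _ b<a | tri< b<c _ _ | tri< a<c _ _ = three-partners b<a a<c B A C
      ... | tri> _ _ b<a | tri< b<c _ _ | tri> _ _ c<a = three-partners b<c c<a B C A
      ... | tri> _ _ b<a | tri> _ _ c<b | _            = three-partners c<b b<a C B A

      Ends : ℕ → ℕ → ℕ → Set
      Ends a b n = n ≡ a ⊎ n ≡ b

      negative-end : ∀ {a b} → e < 0ℚ → f a * f b ≡ e → ∃ λ n → Ends a b n × Partner n
      negative-end {a} {b} e<0 ab≡e with <-cmp (f a) 0ℚ | <-cmp (f b) 0ℚ
      ... | tri< a<0 _ _ | tri> _ _ 0<b = a , inj₁ refl , b , a<0 , 0<b , ab≡e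
      ... | tri> _ _ 0<a | tri< b<0 _ _ = b , inj₂ refl , a , b<0 , 0<a , trans (*-comm (f b) (f a))
            ab≡e
      ... | tri≈ _ a≡0 _ | _ = contradiction (trans (sym ab≡e) (trans (cong (_* f b) a≡0)
            (*-zeroˡ (f b)))) (<⇒≢ e<0)
      ... | _ | tri≈ _ b≡0 _ = contradiction (trans (sym ab≡e) (trans (cong (f a *_) b≡0)
            (*-zeroʳ (f a)))) (<⇒≢ e<0)
      ... | tri< a<0 _ _ | tri< b<0 _ _ =
            contradiction (subst (0ℚ <_) (trans (solve 2 (λ a b → (:- a) :* (:- b)
            := a :* b) refl (f a) (f b)) ab≡e)
              (*-pos (0<neg a<0) (0<neg b<0))) (<-asym e<0)
      ... | tri> _ _ 0<a | tri> _ _ 0<b = contradiction (subst (0ℚ <_) ab≡e (*-pos 0<a 0<b))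
            (<-asym e<0)

      Apart : ℕ → ℕ → ℕ → ℕ → Set
      Apart a b c d = a ≢ c × a ≢ d × b ≢ c × b ≢ d

      ends-apart : ∀ {a b c d n n′} → Apart a b c d → Ends a b n → Ends c d n′ → n ≢ n′
      ends-apart (ac , ad , bc , bd) (inj₁ refl) (inj₁ refl) = ac
      ends-apart (ac , ad , bc , bd) (inj₁ refl) (inj₂ refl) = ad
      ends-apart (ac , ad , bc , bd) (inj₂ refl) (inj₁ refl) = bc
      ends-apart (ac , ad , bc , bd) (inj₂ refl) (inj₂ refl) = bd

      zero-end : ∀ {a b} → f a * f b ≡ 0ℚ → ∃ λ n → Ends a b n × f n ≡ 0ℚ
      zero-end {a} {b} z with p*q≡0⇒p≡0⊎q≡0 {f a} {f b} z
      ... | inj₁ a≡0 = a , inj₁ refl , a≡0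
      ... | inj₂ b≡0 = b , inj₂ refl , b≡0

      -- If e < 0, every chord has exactly one end with negative `f`, and three such ends are
      -- impossible. If e = 0, every chord has an end with `f` = 0, which two chords would share by
      -- injectivity.
      no-three-chords : ∀ {a b c d g h} → Apart a b c d → Apart a b g h → Apart c d g h → 0ℚ ≤ - e →
                        f a * f b ≡ e → f c * f d ≡ e → f g * f h ≡ e → ⊥
      no-three-chords {a} {b} {c} {d} {g} {h} A B C 0≤-e e₁ e₂ e₃ with <-cmp e 0ℚ
      ... | tri< e<0 _ _
            with negative-end {a} {b} e<0 e₁ | negative-end {c} {d} e<0 e₂ | negative-end {g} {h}
            e<0 e₃
      ...   | n₁ , E₁ , P₁ | n₂ , E₂ , P₂ | n₃ , E₃ , P₃ =
        three-distinct-partners (ends-apart A E₁ E₂) (ends-apart B E₁ E₃) (ends-apart C E₂ E₃)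
            P₁ P₂ P₃
      no-three-chords {a} {b} {c} {d} A B C 0≤-e e₁ e₂ e₃ | tri≈ _ refl _
          with zero-end {a} {b} e₁ | zero-end {c} {d} e₂
      ...   | n₁ , E₁ , z₁ | n₂ , E₂ , z₂ = ends-apart A E₁ E₂ (f-injective (trans z₁ (sym z₂)))
      no-three-chords A B C 0≤-e e₁ e₂ e₃ | tri> _ _ 0<e =
        <-irrefl refl (<-≤-trans 0<e (subst (_≤ 0ℚ) (solve 1 (λ e → :- (:- e)
            := e) refl e) (neg-antimono-≤ 0≤-e)))

  module _ (i : ℕ) where

    private
      denominator : ℚ
      denominator = 1ℚ + power i * power i

      instance
        denominator-positive : Positive denominator
        denominator-positive = positive (+-pos 0<1 (*-pos (power>0 i) (power>0 i)))

        denominator-nonZero : NonZero denominator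
        denominator-nonZero = pos⇒nonZero denominator

    weight : ℚ
    weight = 1/ denominator

    weight-inverse : weight * (1ℚ + power i * power i) ≡ 1ℚ
    weight-inverse = *-inverseˡ denominator

    weight>0 : 0ℚ < weight
    weight>0 = positive⁻¹ weight ⦃ 1/pos⇒pos denominator ⦄

  -- Parameters in the ratio 2 exclude concurrent chords, see three-partners.
  point : ℕ → Point
  point i = weight i , power i * weight i

  orientation>0 : ∀ {i j l} → i ℕ.< j → j ℕ.< l → 0ℚ < orientation (point i) (point j) (point l)
  orientation>0 {i} {j} {l} i<j j<l = subst (0ℚ <_)
    (sym (orientation-circle (power i) (power j) (power l) (weight i) (weight j) (weight l)
        (weight-inverse i) (weight-inverse j) (weight-inverse l)))
    (*-pos (*-pos (*-pos (<⇒0<- (power-mono-< i<j)) (<⇒0<- (power-mono-< (ℕ.<-trans i<j j<l))))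
        (<⇒0<- (power-mono-< j<l)))
           (*-pos (*-pos (weight>0 i) (weight>0 j)) (weight>0 l)))

  point-injective : ∀ {i j} → point i ≡ point j → i ≡ j
  point-injective {i} {j} e with ℕ.<-cmp i j | same
    where
    same : power i ≡ power j
    same = begin
      power i                                            ≡⟨ *-identityʳ (power i) ⟨
      power i * 1ℚ                                       ≡⟨ cong (power i *_) (weight-inverse i) ⟨
      power i * (weight i * (1ℚ + power i * power i))    ≡⟨ *-assoc (power i) (weight i) _ ⟨
      power i * weight i * (1ℚ + power i * power i)      ≡⟨ cong (_* (1ℚ + power i * power i))
          (cong proj₂ e) ⟩
      power j * weight j * (1ℚ + power i * power i)      ≡⟨ *-assoc (power j) (weight j) _ ⟩
      power j * (weight j * (1ℚ + power i * power i))    ≡⟨ cong (λ u →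
          power j * (u * (1ℚ + power i * power i))) (cong proj₁ e) ⟨
      power j * (weight i * (1ℚ + power i * power i))    ≡⟨ cong (power j *_) (weight-inverse i) ⟩
      power j * 1ℚ                                       ≡⟨ *-identityʳ (power j) ⟩
      power j                                            ∎
      where open ≡-Reasoning
  ... | tri< i<j _ _ | s = contradiction s (<⇒≢ (power-mono-< i<j))
  ... | tri≈ _ i≡j _ | s = i≡j
  ... | tri> _ _ j<i | s = contradiction (sym s) (<⇒≢ (power-mono-< j<i))

  drawing : (G : Graph) → ConvexDrawing G
  drawing G = record
    { position           = point ∘ toℕ
    ; position-injective = toℕ-injective ∘ point-injective
    ; centre             = ½ , 0ℚ
    ; radius             = ½
    ; radius>0           = positive⁻¹ ½
    ; on-circle          = λ u → circle-equation (power (toℕ u)) (weight (toℕ u)) (weight-inverse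
        (toℕ u))
    ; cyclicOrder        = Permutation.id
    ; counterclockwise   = orientation>0
    }

  no-triple-crossing : (G : Graph) → ConvexDrawing.NoTripleCrossing (drawing G)
  no-triple-crossing G {a} {b} {c} {d} {g} {h} _ _ _
    ((a≢b ∷ a≢c ∷ a≢d ∷ a≢g ∷ a≢h ∷ []) ∷ (b≢c ∷ b≢d ∷ b≢g ∷ b≢h ∷ []) ∷ (c≢d ∷ c≢g ∷ c≢h ∷ []) ∷
        (d≢g ∷ d≢h ∷ []) ∷ _)
    ((x , y) , p₁ , p₂ , p₃) =
    no-three-chords
      (a≢c ∘ toℕ-injective , a≢d ∘ toℕ-injective , b≢c ∘ toℕ-injective , b≢d ∘ toℕ-injective)
      (a≢g ∘ toℕ-injective , a≢h ∘ toℕ-injective , b≢g ∘ toℕ-injective , b≢h ∘ toℕ-injective)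
      (c≢g ∘ toℕ-injective , c≢h ∘ toℕ-injective , d≢g ∘ toℕ-injective , d≢h ∘ toℕ-injective)
      (subst (λ e → 0ℚ ≤ - e) (AB.product) AB.product≤0) AB.product CD.product GH.product
    where
    module OnChord (u w : Fin (Graph.order G)) = Chord (power (toℕ u)) (power (toℕ w))
        (weight (toℕ u)) (weight (toℕ w))
      (weight-inverse (toℕ u)) (weight-inverse (toℕ w)) (weight>0 (toℕ u)) (weight>0 (toℕ w)) x y
    module AB = OnChord a b p₁
    module CD = OnChord c d p₂
    module GH = OnChord g h p₃
    open Concurrent x y AB.x>0

-- The Helly property of subtrees, and brambles

module Brambles where

  open import Data.Empty using (⊥)
  open import Data.Fin as Fin using (Fin; zero; suc; fromℕ<)
  import Data.Fin.Properties as Fin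
  open import Data.Fin.Subset using (Subset; _∈_; ∣_∣; _-_)
  open import Data.Fin.Subset.Properties using (_∈?_; x∈p⇒∣p-x∣<∣p∣; x∈p∧x≢y⇒x∈p-y)
  open import Data.List using (List; []; _∷_; _∷ʳ_; length; lookup)
  import Data.List.Membership.Propositional as List
  open import Data.List.Membership.Propositional.Properties using (∈-lookup)
  open import Data.List.Relation.Unary.All as All using (All; []; _∷_)
  open import Data.List.Relation.Unary.Any using (here; there)
  open import Data.List.Relation.Unary.AllPairs using ([]; _∷_)
  open import Data.List.Relation.Unary.Linked using (Linked; []; [-]; _∷_)
  open import Data.List.Relation.Unary.Unique.Propositional using (Unique)
  open import Data.Nat as ℕ using (ℕ; zero; suc; _+_; _≤_; _<_; z≤n; s≤s)
  import Data.Nat.Properties as ℕ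
  open import Data.Product using (_×_; _,_; proj₁; proj₂; ∃)
  open import Data.Sum using (_⊎_; inj₁; inj₂)
  open import Function using (_∘_)
  open import Function.Definitions using (Injective)
  open import Relation.Binary.Construct.Closure.ReflexiveTransitive as Star using
      (Star; ε; _◅_; _◅◅_)
  open import Relation.Binary.PropositionalEquality
  open import Relation.Nullary using (¬_; yes; no; Dec; contradiction)
  open import Relation.Nullary.Decidable using (_×-dec_; ¬?; decidable-stable)

  lookup-injective : {A : Set} {xs : List A} → Unique xs → Injective _≡_ _≡_ (lookup xs)
  lookup-injective {xs = x ∷ xs} (x∉ ∷ u) {zero}  {zero}  _ = refl
  lookup-injective {xs = x ∷ xs} (x∉ ∷ u) {zero}  {suc j} e =
      contradiction e (All.lookup x∉ (∈-lookup j))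
  lookup-injective {xs = x ∷ xs} (x∉ ∷ u) {suc i} {zero}  e =
      contradiction (sym e) (All.lookup x∉ (∈-lookup i))
  lookup-injective {xs = x ∷ xs} (x∉ ∷ u) {suc i} {suc j} e = cong suc (lookup-injective u e)

  injective-into-subset : ∀ {M n} (X : Subset n) (g : Fin M → Fin n) → Injective _≡_ _≡_ g →
      (∀ c → g c ∈ X) → M ≤ ∣ X ∣
  injective-into-subset {zero}  X g inj g∈X = z≤n
  injective-into-subset {suc M} X g inj g∈X = ℕ.≤-trans
    (s≤s (injective-into-subset (X - g zero) (g ∘ suc) (Fin.suc-injective ∘ inj)
           (λ c → x∈p∧x≢y⇒x∈p-y (g∈X (suc c)) (λ e → Fin.0≢1+n (sym (inj e))))))
    (x∈p⇒∣p-x∣<∣p∣ (g∈X zero))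

  -- Otherwise one preimage in X for each label gives M distinct elements. It is used both for lines
  -- and for columns of the ladders.
  missed-label : ∀ {M n} (X : Subset n) (f : Fin n → Fin M) → ∣ X ∣ < M → ∃ λ c → ∀ {x} → x ∈ X →
      f x ≢ c
  missed-label {M} X f ∣X∣<M with Fin.any? (λ c → ¬? (hit? c))
    where
    hit? : ∀ c → Dec (∃ λ x → x ∈ X × f x ≡ c)
    hit? c = Fin.any? (λ x → (x ∈? X) ×-dec (f x Fin.≟ c))
  ... | yes (c , miss) = c , λ x∈X e → miss (_ , x∈X , e)
  ... | no  allHit     = contradiction (injective-into-subset X (proj₁ ∘ hit) hit-injective
        (proj₁ ∘ proj₂ ∘ hit)) (ℕ.<⇒≱ ∣X∣<M)
    where
    hit : ∀ c → ∃ λ x → x ∈ X × f x ≡ c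
    hit c = decidable-stable (Fin.any? (λ x → (x ∈? X) ×-dec (f x Fin.≟ c))) (λ miss →
        allHit (c , miss))

    hit-injective : Injective _≡_ _≡_ (proj₁ ∘ hit)
    hit-injective {c} {d} e = trans (sym (proj₂ (proj₂ (hit c)))) (trans (cong f e)
        (proj₂ (proj₂ (hit d))))

  module _ {V : Set} where

    Avoiding : (V → V → Set) → V → V → V → Set
    Avoiding R t a b = R a b × a ≢ t × b ≢ t

    last-exit : {R : V → V → Set} → (∀ x y → Dec (x ≡ y)) → ∀ {t z} → Star R t z → z ≢ t →
                ∃ λ p → R t p × Star (Avoiding R t) p z
    last-exit {R} _≟_ {t} {z} w z≢t with leave w
      where
      leave : ∀ {x} → Star R x z → (x ≢ t × Star (Avoiding R t) x z) ⊎ (∃ λ p →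
          R t p × Star (Avoiding R t) p z)
      leave ε = inj₁ (z≢t , ε)
      leave {x} (r ◅ w) with leave w
      ... | inj₂ found = inj₂ found
      ... | inj₁ (y≢t , w′) with x ≟ t
      ...   | yes refl = inj₂ (_ , r , w′)
      ...   | no  x≢t  = inj₁ (x≢t , (r , x≢t , y≢t) ◅ w′)
    ... | inj₁ (t≢t , _) = contradiction refl t≢t
    ... | inj₂ found     = found

  module Tree (T : Graph) (isTree : IsTree T) where
    open Graph T
    open IsTree isTree

    ~⇒≢ : ∀ {a b} → a ~ b → a ≢ b
    ~⇒≢ a~b refl = ~-irrefl refl a~b

    open import Data.List.Membership.DecPropositional (Fin._≟_ {order}) using () renaming
        (_∈?_ to _∈ₗ?_)

    _∖_ : (Vertex → Vertex → Set) → Vertex → Vertex → Vertex → Set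
    R ∖ t = Avoiding R t

    data Chain (q : Vertex) : Vertex → List Vertex → Set where
      end : Chain q q []
      _∷_ : ∀ {p p′ xs} → p ~ p′ → Chain q p′ xs → Chain q p (p′ ∷ xs)

    Simple : Vertex → Vertex → Vertex → Set
    Simple t q p = ∃ λ xs → Chain q p xs × Unique (p ∷ xs) × All (t ≢_) (p ∷ xs)

    suffix : ∀ {t q p a xs} → Chain q a xs → Unique (a ∷ xs) → All (t ≢_) (a ∷ xs) →
        p List.∈ (a ∷ xs) → Simple t q p
    suffix c       u       av       (here refl) = _ , c , u , av
    suffix (r ∷ c) (_ ∷ u) (_ ∷ av) (there p∈)  = suffix c u av p∈

    erase-loops : ∀ {t p q} → p ≢ t → Star (_~_ ∖ t) p q → Simple t q p
    erase-loops p≢t ε = [] , end , ([] ∷ []) , ((p≢t ∘ sym) ∷ [])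
    erase-loops {t} {p} p≢t (_◅_ {j = a} (p~a , _ , a≢t) w) with erase-loops a≢t w
    ... | xs , c , u , av with p ∈ₗ? (a ∷ xs)
    ...   | yes p∈ = suffix c u av p∈
    ...   | no  p∉ = a ∷ xs , p~a ∷ c , All.tabulate (λ { x∈ refl → p∉ x∈ }) ∷ u , (p≢t ∘ sym) ∷ av

    close : ∀ {t q p xs} → q ~ t → Chain q p xs → Linked _~_ (p ∷ xs ∷ʳ t)
    close q~t end     = q~t ∷ [-]
    close q~t (r ∷ c) = r ∷ close q~t c

    -- After loop erasure the walk is a simple chain from p to q off t, and t closes it to a cycle.
    no-detour : ∀ {t p q} → t ~ p → t ~ q → p ≢ q → ¬ Star (_~_ ∖ t) p q
    no-detour {t} {p} t~p t~q p≢q w with erase-loops (~⇒≢ t~p ∘ sym) w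
    ... | []     , end , _ , _ = p≢q refl
    ... | x ∷ xs , c , u , av  = acyclic t (p ∷ x ∷ xs) (s≤s (s≤s z≤n) , av ∷ u , t~p ∷
          close (~-sym t~q) c)

    ∖-sym : ∀ {t a b} → (_~_ ∖ t) a b → (_~_ ∖ t) b a
    ∖-sym (r , a≢t , b≢t) = ~-sym r , b≢t , a≢t

    -- The second walk leaves s for the last time towards some neighbour p ≠ q. Its remainder,
    -- reversed and put behind the first walk, is a detour from q to p around s.
    no-bypass : ∀ {s q z} → s ~ q → z ≢ s → Star (_~_ ∖ s) q z → ¬ Star (_~_ ∖ q) s z
    no-bypass s~q z≢s w w′ with last-exit Fin._≟_ w′ z≢s
    ... | p , (s~p , _ , p≢q) , v = no-detour s~q s~p (p≢q ∘ sym) (w ◅◅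
          Star.reverse ∖-sym (Star.map (λ ((r , _) , a , b) → r , a , b) v))

    module _ {I : Set} (P : I → Vertex → Set)
             (linked : ∀ i {s t} → P i s → P i t → Star (λ a b → a ~ b × P i a × P i b) s t)
             (meet : ∀ i j → ∃ λ t → P i t × P j t)
             (miss : ∀ t → ∃ λ i → ¬ P i t) where

      missing : Vertex → I
      missing t = proj₁ (miss t)

      -- All of the subtree missing t lies behind one neighbour of t.
      Behind : Vertex → Vertex → Set
      Behind t p = t ~ p × (∀ {z} → P (missing t) z → Star (_~_ ∖ t) p z)

      present⇒≢ : ∀ {t a} → P (missing t) a → a ≢ t
      present⇒≢ Pa refl = proj₂ (miss _) Pa

      -- The missed subtree is connected and avoids t, so the final part of one walk from t into it
      -- extends to all of its nodes without returning to t.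
      toward : ∀ t → ∃ (Behind t)
      toward t = p , t~p , λ Pz → w ◅◅ Star.map (λ (r , Pa , Pb) → r , present⇒≢ Pa , present⇒≢ Pb)
          (linked (missing t) Pz₀ Pz)
        where
        z₀ = proj₁ (meet (missing t) (missing t))
        Pz₀ = proj₁ (proj₂ (meet (missing t) (missing t)))
        exit = last-exit Fin._≟_ (connected t z₀) (present⇒≢ Pz₀)
        p = proj₁ exit
        t~p = proj₁ (proj₂ exit)
        w = proj₂ (proj₂ exit)

      -- The subtrees missed by s and by q share a node, which would lie beyond the edge between s
      -- and q from both of its ends.
      no-return : ∀ {q s} → Behind q s → ¬ Behind s q
      no-return {q} {s} (q~s , f) (s~q , g) with meet (missing s) (missing q)
      ... | z , Ps , Pq = no-bypass s~q (present⇒≢ Ps) (g Ps) (f Pq)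

      walk-along : ∀ {s q x xs} → All (s ≢_) (q ∷ xs) → Linked _~_ (q ∷ xs) → x List.∈ (q ∷ xs) →
          Star (_~_ ∖ s) q x
      walk-along av l (here refl) = ε
      walk-along (s≢q ∷ av@(s≢a ∷ _)) (r ∷ l) (there x∈) = (r , s≢q ∘ sym , s≢a ∘ sym) ◅
          walk-along av l x∈

      -- A walk towards the missed subtrees never turns back, so that its nodes
      -- stay distinct.
      endless : ∀ fuel {s q xs} → order < fuel + length (s ∷ q ∷ xs) →
                Linked _~_ (s ∷ q ∷ xs) → Unique (s ∷ q ∷ xs) → Behind q s → ⊥
      endless zero big l u b = ℕ.<⇒≱ big (Fin.injective⇒≤ (lookup-injective u))
      endless (suc fuel) {s} {q} {xs} big l@(_ ∷ l′) u@(s∉ ∷ _) b with toward s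
      ... | p , b′@(s~p , _) with p ∈ₗ? (q ∷ xs) | p Fin.≟ q
      ...   | _      | yes refl = no-return b b′
      ...   | yes p∈ | no p≢q   = no-detour (~-sym (proj₁ b)) s~p (p≢q ∘ sym) (walk-along s∉ l′ p∈)
      ...   | no p∉  | no p≢q   = endless fuel (subst (order <_) (sym (ℕ.+-suc fuel _)) big)
            (~-sym s~p ∷ l)
        ((~⇒≢ (~-sym s~p) ∷ All.tabulate (λ { x∈ refl → p∉ x∈ })) ∷ u) b′

      helly : ⊥
      helly with toward (fromℕ< (ℕ.>-nonZero⁻¹ order ⦃ nonEmpty ⦄))
      ... | p , b@(r , _) = endless order (ℕ.m<m+n order (s≤s z≤n)) (~-sym r ∷
            [-]) ((~⇒≢ (~-sym r) ∷ []) ∷ ([] ∷ [])) b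

  module _ {G : Graph} (D : TreeDecomposition G) where
    open Graph G
    open TreeDecomposition D

    -- The nodes whose bags meet a fixed connected set form a subtree, and a common vertex of two
    -- sets yields a common node, so `helly` applies.
    bramble-covered : {I : Set} (S : I → Vertex → Set) →
      (∀ i {x y} → S i x → S i y → Star (λ a b → a ~ b × S i a × S i b) x y) →
      (∀ i j → ∃ λ x → S i x × S j x) →
      ¬ (∀ t → ∃ λ i → ∀ {x} → x ∈ bag t → ¬ S i x)
    bramble-covered {I} S linked meet avoided = Tree.helly tree isTree P linkedᵀ meetᵀ missᵀ
      where
      P : I → Node → Set
      P i t = ∃ λ x → S i x × x ∈ bag t

      linkedᵀ : ∀ i {s t} → P i s → P i t → Star (λ a b → a ~ᵀ b × P i a × P i b) s t
      linkedᵀ i (x , Sx , x∈) (y , Sy , y∈) = along Sx (linked i Sx Sy) x∈ y∈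
        where
        along : ∀ {x y s t} → S i x → Star (λ a b → a ~ b × S i a × S i b) x y → x ∈ bag s →
            y ∈ bag t →
                Star (λ a b → a ~ᵀ b × P i a × P i b) s t
        along {x} Sx ε x∈ y∈ = Star.map (λ (r , a , b) → r , (x , Sx , a) , (x , Sx , b))
            (subtree x x∈ y∈)
        -- The bag that covers the edge from x to a is where the subtree of x is left for that of a.
        along {x} Sx ((x~a , _ , Sa) ◅ w) x∈ y∈ with coversEdge x~a
        ... | r , x∈r , a∈r = along Sx ε x∈ x∈r ◅◅ along Sa w a∈r y∈

      meetᵀ : ∀ i j → ∃ λ t → P i t × P j t
      meetᵀ i j with meet i j
      ... | x , Si , Sj with coversVertex x
      ...   | t , x∈ = t , (x , Si , x∈) , (x , Sj , x∈)

      missᵀ : ∀ t → ∃ λ i → ¬ P i t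
      missᵀ t with avoided t
      ... | i , away = i , λ (x , Sx , x∈) → away x∈ Sx

-- Two nested matchings and the crossings between them

module Crossings where

  open LinearArithmetic
  open import Data.Empty using (⊥; ⊥-elim)
  open import Data.Fin as Fin using (Fin; toℕ)
  open import Data.Fin.Properties using (toℕ<n)
  open import Data.List using ([]; _∷_)
  open import Data.Nat
  open import Data.Nat.Properties
  open import Data.Product using (_×_; _,_; ∃)
  open import Data.Sum as Sum using (_⊎_; inj₁; inj₂)
  open import Relation.Binary.PropositionalEquality
  open import Relation.Binary.Definitions using (tri<; tri≈; tri>)
  open import Relation.Nullary

  -- A crossing of the chord from i to j in which the crossing edge is directed: x is its end
  -- inside, y its end outside.
  Across : (i j x y : ℕ) → Set
  Across i j x y = i < x × x < j × (y < i ⊎ j < y)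

  module Matchings (m N : ℕ) (0<N : 0 < N) where

    -- The conditions imply that a and b are less than L + N.
    Mirror : ℕ → ℕ → ℕ → Set
    Mirror L a b = L ≤ a × L ≤ b × suc (a + b) ≡ 2 * L + N

    base : Fin 3 → ℕ
    base z = N * toℕ z

    -- The block of the rotated matching that wraps around.
    Outer : ℕ → ℕ → Set
    Outer a b = 3 * N ≤ b + m × suc (a + b + 2 * m) ≡ 4 * N

    Match₁ Match₂ : ℕ → ℕ → Set
    Match₁ a b = ∃ λ z → Mirror (base z) a b
    Match₂ a b = (∃ λ z → Mirror (base z) (a + m) (b + m)) ⊎ Outer a b ⊎ Outer b a

    Mirror-sym : ∀ {L a b} → Mirror L a b → Mirror L b a
    Mirror-sym {L} {a} {b} (p , q , e) = q , p , trans (cong suc (+-comm b a)) e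

    Match₁-sym : ∀ {a b} → Match₁ a b → Match₁ b a
    Match₁-sym (z , r) = z , Mirror-sym r

    Match₂-sym : ∀ {a b} → Match₂ a b → Match₂ b a
    Match₂-sym (inj₁ (z , r)) = inj₁ (z , Mirror-sym r)
    Match₂-sym (inj₂ o)       = inj₂ (Sum.swap o)

    base-apart : ∀ {z z′} → toℕ z < toℕ z′ → base z + N ≤ base z′
    base-apart {z} {z′} z<z′ =
        ≤-trans (≤-reflexive (trans (+-comm (base z) N) (sym (*-suc N (toℕ z))))) (*-monoʳ-≤ N z<z′)

    base-compare : ∀ z z′ → base z ≡ base z′ ⊎ base z + N ≤ base z′ ⊎ base z′ + N ≤ base z
    base-compare z z′ with <-cmp (toℕ z) (toℕ z′)
    ... | tri< z<z′ _ _ = inj₂ (inj₁ (base-apart {z} {z′} z<z′))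
    ... | tri≈ _ z≡z′ _ = inj₁ (cong (N *_) z≡z′)
    ... | tri> _ _ z′<z = inj₂ (inj₂ (base-apart {z′} {z} z′<z))

    base+N≤3N : ∀ z → base z + N ≤ 3 * N
    base+N≤3N z = ≤-trans (≤-reflexive (trans (+-comm (base z) N) (sym (*-suc N (toℕ z)))))
      (≤-trans (*-monoʳ-≤ N (toℕ<n z)) (≤-reflexive (*-comm N 3)))

    base-zero-or-≥N : ∀ z → base z ≡ 0 ⊎ N ≤ base z
    base-zero-or-≥N Fin.zero    = inj₁ (*-zeroʳ N)
    base-zero-or-≥N (Fin.suc z) = inj₂ (m≤m*n N (suc (toℕ z)))

    Mirror-functional : ∀ {z z′ a b b′} → Mirror (base z) a b → Mirror (base z′) a b′ → b ≡ b′
    Mirror-functional {z} {z′} {a} {b} {b′} (p , q , e) (p′ , q′ , e′) with base-compare z z′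
    ... | inj₁ L≡L′ =
          +-cancelˡ-≡ a b b′ (suc-injective (trans e (trans (cong (λ L → 2 * L + N) L≡L′)
          (sym e′))))
    ... | inj₂ (inj₁ L<L′) = ⊥-elim (refute 5 (λ N L L′ a b →
        L :+ N :≤ L′ ∷ L′ :≤ a ∷ L :≤ b ∷ con 1 :+ (a :+ b) :≡ 2 :* L :+ N ∷ [])
        N (base z) (base z′) a b L<L′ p′ q e)
    ... | inj₂ (inj₂ L′<L) = ⊥-elim (refute 5 (λ N L L′ a b →
        L :+ N :≤ L′ ∷ L′ :≤ a ∷ L :≤ b ∷ con 1 :+ (a :+ b) :≡ 2 :* L :+ N ∷ [])
        N (base z′) (base z) a b′ L′<L p q′ e′)

    Match₁-functional : ∀ {a b b′} → Match₁ a b → Match₁ a b′ → b ≡ b′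
    Match₁-functional (z , r) (z′ , r′) = Mirror-functional {z} {z′} r r′

    Mirror-Outer : ∀ {z a b b′} → b′ < 3 * N → Mirror (base z) (a + m) (b + m) → Outer a b′ → ⊥
    Mirror-Outer {z} {a} {b} {b′} b′< (p , q , e) (s , f) with base-zero-or-≥N z
    ... | inj₁ L≡0 = refute 6 (λ a b b′ L N m →
        b′ :< 3 :* N ∷ con 1 :+ (a :+ m :+ (b :+ m)) :≡ 2 :* L :+ N ∷
        con 1 :+ (a :+ b′ :+ 2 :* m) :≡ 4 :* N ∷ L :≡ con 0 ∷ [])
        a b b′ (base z) N m b′< e f L≡0
    ... | inj₂ N≤L = refute 5 (λ a b′ L N m →
        L :≤ a :+ m ∷ 3 :* N :≤ b′ :+ m ∷ con 1 :+ (a :+ b′ :+ 2 :* m) :≡ 4 :* N ∷ N :≤ L ∷ [])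
        a b′ (base z) N m p s f N≤L

    Mirror-Outer′ : ∀ {z a b b′} → Mirror (base z) (a + m) (b + m) → Outer b′ a → ⊥
    Mirror-Outer′ {z} {a} {b} {b′} (p , q , e) (s , f) =
      refute 5 (λ a b L N m →
          L :+ N :≤ 3 :* N ∷ 3 :* N :≤ a :+ m ∷ L :≤ b :+ m ∷
          con 1 :+ (a :+ m :+ (b :+ m)) :≡ 2 :* L :+ N ∷ [])
          a b (base z) N m (base+N≤3N z) s q e

    Outer-asym : ∀ {a b b′} → Outer a b → Outer b′ a → ⊥
    Outer-asym {a} {b} {b′} (s , f) (s′ , f′) = refute 4 (λ a b N m →
        con 0 :< N ∷ 3 :* N :≤ b :+ m ∷ 3 :* N :≤ a :+ m ∷ con 1 :+ (a :+ b :+ 2 :* m) :≡ 4 :* N ∷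
        [])
        a b N m 0<N s s′ f

    Match₂-functional : ∀ {a b b′} → b < 3 * N → b′ < 3 * N → Match₂ a b → Match₂ a b′ → b ≡ b′
    Match₂-functional _ _ (inj₁ (z , r)) (inj₁ (z′ , r′)) =
        +-cancelʳ-≡ m _ _ (Mirror-functional {z} {z′} r r′)
    Match₂-functional {b = b} _ b′< (inj₁ (z , r)) (inj₂ (inj₁ o)) =
        ⊥-elim (Mirror-Outer {z} {b = b} b′< r o)
    Match₂-functional {b = b} {b′} _ _ (inj₁ (z , r)) (inj₂ (inj₂ o)) =
        ⊥-elim (Mirror-Outer′ {z} {b = b} {b′} r o)
    Match₂-functional {b′ = b′} b< _ (inj₂ (inj₁ o)) (inj₁ (z , r)) =
        ⊥-elim (Mirror-Outer {z} {b = b′} b< r o)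
    Match₂-functional {b = b} {b′} _ _ (inj₂ (inj₂ o)) (inj₁ (z , r)) =
        ⊥-elim (Mirror-Outer′ {z} {b = b′} {b} r o)
    Match₂-functional {a} {b} {b′} _ _ (inj₂ (inj₁ (_ , e))) (inj₂ (inj₁ (_ , e′))) =
      +-cancelˡ-≡ a b b′ (+-cancelʳ-≡ (2 * m) _ _ (suc-injective (trans e (sym e′))))
    Match₂-functional {a} {b} {b′} _ _ (inj₂ (inj₂ (_ , e))) (inj₂ (inj₂ (_ , e′))) =
      +-cancelʳ-≡ a b b′ (+-cancelʳ-≡ (2 * m) _ _ (suc-injective (trans e (sym e′))))
    Match₂-functional {b = b} {b′} _ _ (inj₂ (inj₁ o)) (inj₂ (inj₂ o′)) =
        ⊥-elim (Outer-asym {b = b} {b′ = b′} o o′)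
    Match₂-functional {b = b} {b′} _ _ (inj₂ (inj₂ o)) (inj₂ (inj₁ o′)) =
        ⊥-elim (Outer-asym {b = b′} {b′ = b} o′ o)

    -- Pairs of one block have equal sums, so they are concentric intervals; pairs of different
    -- blocks lie in disjoint intervals.
    Mirror-nested : ∀ {z z′ i j x y} → Mirror (base z) i j → Mirror (base z′) x y → ¬ Across i j x y
    Mirror-nested {z} {z′} {i} {j} {x} {y} (p , q , e) (p′ , q′ , e′) (i<x , x<j , out)
        with base-compare z z′ | out
    ... | inj₁ L≡L′ | inj₁ y<i = refute 7 (λ N L L′ i j x y →
        L :≡ L′ ∷ con 1 :+ (i :+ j) :≡ 2 :* L :+ N ∷ con 1 :+ (x :+ y) :≡ 2 :* L′ :+ N ∷ x :< j ∷
        y :< i ∷ [])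
        N (base z) (base z′) i j x y L≡L′ e e′ x<j y<i
    ... | inj₁ L≡L′ | inj₂ j<y = refute 7 (λ N L L′ i j x y →
        L :≡ L′ ∷ con 1 :+ (i :+ j) :≡ 2 :* L :+ N ∷ con 1 :+ (x :+ y) :≡ 2 :* L′ :+ N ∷ i :< x ∷
        j :< y ∷ [])
        N (base z) (base z′) i j x y L≡L′ e e′ i<x j<y
    ... | inj₂ (inj₁ L<L′) | _ = refute 6 (λ N L L′ i j x →
        L :+ N :≤ L′ ∷ con 1 :+ (i :+ j) :≡ 2 :* L :+ N ∷ L :≤ i ∷ L′ :≤ x ∷ x :< j ∷ [])
        N (base z) (base z′) i j x L<L′ e p p′ x<j
    ... | inj₂ (inj₂ L′<L) | _ = refute 6 (λ N L L′ i x y →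
        L′ :+ N :≤ L ∷ con 1 :+ (x :+ y) :≡ 2 :* L′ :+ N ∷ L :≤ i ∷ L′ :≤ y ∷ i :< x ∷ [])
        N (base z) (base z′) i x y L′<L e′ p q′ i<x

    Across-+m : ∀ {i j x y} → Across i j x y → Across (i + m) (j + m) (x + m) (y + m)
    Across-+m (p , q , o) = +-monoˡ-< m p , +-monoˡ-< m q , Sum.map (+-monoˡ-< m) (+-monoˡ-< m) o

    no-Outer-downwards : ∀ {i j} → i < j → ¬ Outer j i
    no-Outer-downwards {i} {j} i<j (s , e) = refute 4 (λ i j N m →
        con 0 :< N ∷ i :< j ∷ 3 :* N :≤ i :+ m ∷ con 1 :+ (j :+ i :+ 2 :* m) :≡ 4 :* N ∷ [])
        i j N m 0<N i<j s e

    Mirror-nested-Outer : ∀ {z i j x y} → i < j → Mirror (base z) (i + m) (j + m) → Outer x y →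
        y < 3 * N → ¬ (Across i j x y ⊎ Across i j y x)
    Mirror-nested-Outer {z} {i} {j} {x} {y} i<j (p , q , e) (s , f) y< (inj₁ (i<x , x<j , _))
        with base-zero-or-≥N z
    ... | inj₁ L≡0 = refute 7 (λ i j x y L N m →
        con 1 :+ (i :+ m :+ (j :+ m)) :≡ 2 :* L :+ N ∷ L :≡ con 0 ∷ x :< j ∷
        con 1 :+ (x :+ y :+ 2 :* m) :≡ 4 :* N ∷ y :< 3 :* N ∷ [])
        i j x y (base z) N m e L≡0 x<j f y<
    ... | inj₂ N≤L = refute 6 (λ i x y L N m →
        L :≤ i :+ m ∷ N :≤ L ∷ i :< x ∷ con 1 :+ (x :+ y :+ 2 :* m) :≡ 4 :* N ∷ 3 :* N :≤ y :+ m ∷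
        [])
        i x y (base z) N m p N≤L i<x f s
    Mirror-nested-Outer {z} {i} {j} {x} {y} i<j (p , q , e) (s , f) y< (inj₂ (i<y , y<j , _)) =
      refute 6 (λ i j y L N m →
          L :+ N :≤ 3 :* N ∷ L :≤ i :+ m ∷ con 1 :+ (i :+ m :+ (j :+ m)) :≡ 2 :* L :+ N ∷ y :< j ∷
          3 :* N :≤ y :+ m ∷ [])
          i j y (base z) N m (base+N≤3N z) p e y<j s

    Outer-nested-Mirror : ∀ {z i j x y} → j < 3 * N → Outer i j → Mirror (base z) (x + m) (y + m) →
        ¬ Across i j x y
    Outer-nested-Mirror {z} {i} {j} {x} {y} j< (s , e) (p , q , f) (i<x , x<j , inj₁ y<i)
        with base-zero-or-≥N z
    ... | inj₁ L≡0 = refute 7 (λ i j x y L N m →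
        con 1 :+ (i :+ j :+ 2 :* m) :≡ 4 :* N ∷ j :< 3 :* N ∷
        con 1 :+ (x :+ m :+ (y :+ m)) :≡ 2 :* L :+ N ∷ L :≡ con 0 ∷ i :< x ∷ [])
        i j x y (base z) N m e j< f L≡0 i<x
    ... | inj₂ N≤L = refute 6 (λ i j y L N m →
        con 1 :+ (i :+ j :+ 2 :* m) :≡ 4 :* N ∷ 3 :* N :≤ j :+ m ∷ L :≤ y :+ m ∷ N :≤ L ∷ y :< i ∷
        [])
        i j y (base z) N m e s q N≤L y<i
    Outer-nested-Mirror {z} {i} {j} {x} {y} j< (s , e) (p , q , f) (i<x , x<j , inj₂ j<y) =
      refute 6 (λ j x y L N m →
          L :+ N :≤ 3 :* N ∷ L :≤ x :+ m ∷ con 1 :+ (x :+ m :+ (y :+ m)) :≡ 2 :* L :+ N ∷ j :< y ∷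
          3 :* N :≤ j :+ m ∷ [])
          j x y (base z) N m (base+N≤3N z) p f j<y s

    Outer-nested-Outer : ∀ {i j x y} → i < j → Outer i j → Outer x y →
        ¬ (Across i j x y ⊎ Across i j y x)
    Outer-nested-Outer {i} {j} {x} {y} i<j (s , e) (t , f) (inj₁ (i<x , x<j , inj₁ y<i)) =
      refute 6 (λ i j x y N m →
          con 0 :< N ∷ con 1 :+ (x :+ y :+ 2 :* m) :≡ 4 :* N ∷ 3 :* N :≤ y :+ m ∷ i :< x ∷ y :< i ∷
          [])
          i j x y N m 0<N f t i<x y<i
    Outer-nested-Outer {i} {j} {x} {y} i<j (s , e) (t , f) (inj₁ (i<x , x<j , inj₂ j<y)) =
      refute 6 (λ i j x y N m →
          con 1 :+ (i :+ j :+ 2 :* m) :≡ 4 :* N ∷ con 1 :+ (x :+ y :+ 2 :* m) :≡ 4 :* N ∷ i :< x ∷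
          j :< y ∷ [])
          i j x y N m e f i<x j<y
    Outer-nested-Outer {i} {j} {x} {y} i<j (s , e) (t , f) (inj₂ (i<y , y<j , inj₁ x<i)) =
      refute 6 (λ i j x y N m →
          con 1 :+ (i :+ j :+ 2 :* m) :≡ 4 :* N ∷ con 1 :+ (x :+ y :+ 2 :* m) :≡ 4 :* N ∷ y :< j ∷
          x :< i ∷ [])
          i j x y N m e f y<j x<i
    Outer-nested-Outer {i} {j} {x} {y} i<j (s , e) (t , f) (inj₂ (i<y , y<j , inj₂ j<x)) =
      refute 6 (λ i j x y N m →
          con 0 :< N ∷ con 1 :+ (x :+ y :+ 2 :* m) :≡ 4 :* N ∷ 3 :* N :≤ y :+ m ∷ 3 :* N :≤ j :+ m ∷
          j :< x ∷ [])
          i j x y N m 0<N f t s j<x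

    Match₁-nested : ∀ {i j x y} → Match₁ i j → Match₁ x y → ¬ Across i j x y
    Match₁-nested (z , r) (z′ , r′) = Mirror-nested {z} {z′} r r′

    Match₂-nested : ∀ {i j x y} → i < j → j < 3 * N → x < 3 * N → y < 3 * N → Match₂ i j →
        Match₂ x y → ¬ Across i j x y
    Match₂-nested i<j j< x< y< (inj₁ (z , r)) (inj₁ (z′ , r′)) s = Mirror-nested {z} {z′} r r′
        (Across-+m s)
    Match₂-nested i<j j< x< y< (inj₁ (z , r)) (inj₂ (inj₁ o)) s = Mirror-nested-Outer {z} i<j r o y<
        (inj₁ s)
    Match₂-nested i<j j< x< y< (inj₁ (z , r)) (inj₂ (inj₂ o)) s = Mirror-nested-Outer {z} i<j r o x<
        (inj₂ s)
    Match₂-nested i<j j< x< y< (inj₂ (inj₁ o)) (inj₁ (z , r)) s = Outer-nested-Mirror {z} j< o r s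
    Match₂-nested i<j j< x< y< (inj₂ (inj₁ o)) (inj₂ (inj₁ o′)) s = Outer-nested-Outer i<j o o′
        (inj₁ s)
    Match₂-nested i<j j< x< y< (inj₂ (inj₁ o)) (inj₂ (inj₂ o′)) s = Outer-nested-Outer i<j o o′
        (inj₂ s)
    Match₂-nested i<j j< x< y< (inj₂ (inj₂ o)) _ s = no-Outer-downwards i<j o

    -- In a common block y = i + j - x - 2m. This is less than j since x > i, and it is at least i
    -- as soon as x + 2m ≤ j, so a crossing needs x close to j.
    Match₁-window : ∀ {i j x y} → y < 3 * N → Match₁ i j → Match₂ x y → Across i j x y →
        j < x + 2 * m
    Match₁-window {i} {j} {x} {y} y< (z , p , q , e) (inj₁ (z′ , p′ , q′ , e′)) (i<x , x<j , out) =
        ≰⇒> λ far → far-absurd far (base-compare z z′) out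
      where
      far-absurd : x + 2 * m ≤ j → _ → _ → ⊥
      far-absurd far (inj₁ L≡L′) (inj₁ y<i) =
        refute 8 (λ i j x y L L′ N m →
            L :≡ L′ ∷ con 1 :+ (i :+ j) :≡ 2 :* L :+ N ∷
            con 1 :+ (x :+ m :+ (y :+ m)) :≡ 2 :* L′ :+ N ∷ x :+ 2 :* m :≤ j ∷ y :< i ∷ [])
            i j x y (base z) (base z′) N m L≡L′ e e′ far y<i
      far-absurd far (inj₁ L≡L′) (inj₂ j<y) =
        refute 8 (λ i j x y L L′ N m →
            L :≡ L′ ∷ con 1 :+ (i :+ j) :≡ 2 :* L :+ N ∷
            con 1 :+ (x :+ m :+ (y :+ m)) :≡ 2 :* L′ :+ N ∷ i :< x ∷ j :< y ∷ [])
            i j x y (base z) (base z′) N m L≡L′ e e′ i<x j<y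
      far-absurd far (inj₂ (inj₁ L<L′)) _ =
        refute 7 (λ i j x L L′ N m →
            L :+ N :≤ L′ ∷ con 1 :+ (i :+ j) :≡ 2 :* L :+ N ∷ L :≤ i ∷ L′ :≤ x :+ m ∷
            x :+ 2 :* m :≤ j ∷ [])
            i j x (base z) (base z′) N m L<L′ e p p′ far
      far-absurd far (inj₂ (inj₂ L′<L)) _ =
        refute 7 (λ i x y L L′ N m →
            L′ :+ N :≤ L ∷ con 1 :+ (x :+ m :+ (y :+ m)) :≡ 2 :* L′ :+ N ∷ L :≤ i ∷ L′ :≤ y :+ m ∷
            i :< x ∷ [])
            i x y (base z) (base z′) N m L′<L e′ p q′ i<x
    Match₁-window {i} {j} {x} {y} y< (z , p , q , e) (inj₂ (inj₁ (s , f))) (i<x , x<j , out) =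
        ≰⇒> λ far → far-absurd far (base-zero-or-≥N z)
      where
      far-absurd : x + 2 * m ≤ j → _ → ⊥
      far-absurd far (inj₁ L≡0) = refute 7 (λ i j x y L N m →
          L :≡ con 0 ∷ con 1 :+ (i :+ j) :≡ 2 :* L :+ N ∷ con 1 :+ (x :+ y :+ 2 :* m) :≡ 4 :* N ∷
          y :< 3 :* N ∷ x :+ 2 :* m :≤ j ∷ [])
          i j x y (base z) N m L≡0 e f y< far
      far-absurd far (inj₂ N≤L) = refute 6 (λ i x y L N m →
          N :≤ L ∷ L :≤ i ∷ i :< x ∷ con 1 :+ (x :+ y :+ 2 :* m) :≡ 4 :* N ∷ 3 :* N :≤ y :+ m ∷ [])
          i x y (base z) N m N≤L p i<x f s
    Match₁-window {i} {j} {x} {y} y< (z , p , q , e) (inj₂ (inj₂ (s , f))) (i<x , x<j , out) =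
        ≰⇒> λ far →
      refute 6 (λ i j x L N m →
          con 1 :+ (i :+ j) :≡ 2 :* L :+ N ∷ L :+ N :≤ 3 :* N ∷ L :≤ i ∷ x :+ 2 :* m :≤ j ∷
          3 :* N :≤ x :+ m ∷ [])
          i j x (base z) N m e (base+N≤3N z) p far s

    -- Here y = i + j + 2m - x in a common block, which exceeds i since x < j and is at most j once
    -- x ≥ i + 2m. The window therefore lies behind i.
    Mirror-window : ∀ {z i j x y} → Mirror (base z) (i + m) (j + m) → Match₁ x y → Across i j x y →
        x < i + 2 * m
    Mirror-window {z} {i} {j} {x} {y} (p , q , e) (z′ , p′ , q′ , e′) (i<x , x<j , out) =
        ≰⇒> λ far → far-absurd far (base-compare z z′) out
      where
      far-absurd : i + 2 * m ≤ x → _ → _ → ⊥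
      far-absurd far (inj₁ L≡L′) (inj₁ y<i) =
        refute 8 (λ i j x y L L′ N m →
            L :≡ L′ ∷ con 1 :+ (x :+ y) :≡ 2 :* L′ :+ N ∷
            con 1 :+ (i :+ m :+ (j :+ m)) :≡ 2 :* L :+ N ∷ x :< j ∷ y :< i ∷ [])
            i j x y (base z) (base z′) N m L≡L′ e′ e x<j y<i
      far-absurd far (inj₁ L≡L′) (inj₂ j<y) =
        refute 8 (λ i j x y L L′ N m →
            L :≡ L′ ∷ con 1 :+ (x :+ y) :≡ 2 :* L′ :+ N ∷
            con 1 :+ (i :+ m :+ (j :+ m)) :≡ 2 :* L :+ N ∷ i :+ 2 :* m :≤ x ∷ j :< y ∷ [])
            i j x y (base z) (base z′) N m L≡L′ e′ e far j<y
      far-absurd far (inj₂ (inj₁ L<L′)) _ =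
        refute 7 (λ i j x L L′ N m →
            L :+ N :≤ L′ ∷ con 1 :+ (i :+ m :+ (j :+ m)) :≡ 2 :* L :+ N ∷ L :≤ i :+ m ∷ L′ :≤ x ∷
            x :< j ∷ [])
            i j x (base z) (base z′) N m L<L′ e p p′ x<j
      far-absurd far (inj₂ (inj₂ L′<L)) _ =
        refute 7 (λ i x y L L′ N m →
            L′ :+ N :≤ L ∷ con 1 :+ (x :+ y) :≡ 2 :* L′ :+ N ∷ L :≤ i :+ m ∷ L′ :≤ y ∷
            i :+ 2 :* m :≤ x ∷ [])
            i x y (base z) (base z′) N m L′<L e′ p q′ far

    -- Cyclically, the wrapping chord starts at j and ends at i, so its rotated block lies where the
    -- linear order says outside. The end y takes the role that x has in `Mirror-window`, and 3N is
    -- added if y lies past the cut.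
    Outer-window : ∀ {i j x y} → j < 3 * N → y < 3 * N → Outer i j → Match₁ x y → Across i j x y →
              (j < y × y < j + 2 * m) ⊎ (j < y + 3 * N × y + 3 * N < j + 2 * m)
    Outer-window {i} {j} {x} {y} j< y< (s , e) (z , p , q , f) (i<x , x<j , inj₂ j<y) =
      inj₁ (j<y , ≰⇒> λ far → refute 4 (λ j y N m →
          j :+ 2 :* m :≤ y ∷ y :< 3 :* N ∷ 3 :* N :≤ j :+ m ∷ [])
          j y N m far y< s)
    Outer-window {i} {j} {x} {y} j< y< (s , e) (z , p , q , f) (i<x , x<j , inj₁ y<i) =
      inj₂ (<-≤-trans j< (m≤n+m (3 * N) y) , ≰⇒> λ far → far-absurd far (base-zero-or-≥N z))
      where
      far-absurd : j + 2 * m ≤ y + 3 * N → _ → ⊥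
      far-absurd far (inj₁ L≡0) = refute 7 (λ i j x y L N m →
          L :≡ con 0 ∷ con 1 :+ (x :+ y) :≡ 2 :* L :+ N ∷ con 1 :+ (i :+ j :+ 2 :* m) :≡ 4 :* N ∷
          i :< x ∷ j :+ 2 :* m :≤ y :+ 3 :* N ∷ [])
          i j x y (base z) N m L≡0 f e i<x far
      far-absurd far (inj₂ N≤L) = refute 6 (λ i j y L N m →
          N :≤ L ∷ L :≤ y ∷ y :< i ∷ con 1 :+ (i :+ j :+ 2 :* m) :≡ 4 :* N ∷ 3 :* N :≤ j :+ m ∷ [])
          i j y (base z) N m N≤L q y<i e s

-- The graph, and at most k crossings per edge

module Counting where

  open Crossings
  open Brambles using (lookup-injective)
  open import Data.Empty using (⊥; ⊥-elim)
  open import Data.Fin as Fin using (Fin; toℕ; fromℕ<)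
  open import Data.Fin.Properties as Fin using (toℕ<n; toℕ-injective; toℕ-fromℕ<)
  open import Data.List using (List; length; filter; lookup; allFin; cartesianProduct)
  open import Data.List.Membership.Propositional using (_∈_)
  open import Data.List.Membership.Propositional.Properties using (∈-lookup; ∈-filter⁻)
  open import Data.List.Relation.Unary.All as All using (All)
  open import Data.List.Relation.Unary.Unique.Propositional using (Unique)
  open import Data.List.Relation.Unary.Unique.Propositional.Properties using
      (filter⁺; cartesianProduct⁺; allFin⁺)
  open import Data.Nat
  open import Data.Nat.Properties
  open import Data.Product using (_×_; _,_; proj₁; proj₂; ∃)
  open import Data.Sum as Sum using (_⊎_; inj₁; inj₂)
  open import Relation.Binary.Definitions using (Decidable)
  open import Relation.Binary.PropositionalEquality
  open import Relation.Nullary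
  open import Relation.Nullary.Decidable using (_×-dec_; _⊎-dec_)

  length≤ : ∀ {A : Set} {xs : List A} {k} (R : A → ℕ → Set) → Unique xs →
            (∀ {x} → x ∈ xs → ∃ λ c → c < k × R x c) →
            (∀ {x y c} → R x c → R y c → x ≡ y) → length xs ≤ k
  length≤ {xs = xs} R u label inj = Fin.injective⇒≤ {f = λ i → fromℕ< (proj₁ (proj₂ (label′ i)))}
      (λ {i} {j} e →
    lookup-injective u (inj (proj₂ (proj₂ (label′ i)))
      (subst (R (lookup xs j)) (sym (fromℕ<-inj (proj₁ (proj₂ (label′ i)))
          (proj₁ (proj₂ (label′ j))) e)) (proj₂ (proj₂ (label′ j))))))
    where
    label′ : ∀ i → ∃ λ c → c < _ × R (lookup xs i) c
    label′ i = label (∈-lookup i)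

    fromℕ<-inj : ∀ {a b k} (p : a < k) (q : b < k) → fromℕ< p ≡ fromℕ< q → a ≡ b
    fromℕ<-inj p q e = trans (sym (toℕ-fromℕ< p)) (trans (cong toℕ e) (toℕ-fromℕ< q))

  module Ladders (m K k : ℕ) (0<K : 0 < K) (suc-k : suc k ≡ 2 * m) where

    N : ℕ
    N = 2 * K

    0<N : 0 < N
    0<N = <-≤-trans 0<K (m≤m+n K (K + 0))

    open Matchings m N 0<N public

    Adjacent : ℕ → ℕ → Set
    Adjacent a b = (suc a ≡ b ⊎ suc b ≡ a) ⊎ Match₁ a b ⊎ Match₂ a b

    Mirror? : ∀ L → Decidable (Mirror L)
    Mirror? L a b = (L ≤? a) ×-dec (L ≤? b) ×-dec (suc (a + b) ≟ 2 * L + N)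

    Outer? : Decidable Outer
    Outer? a b = (3 * N ≤? b + m) ×-dec (suc (a + b + 2 * m) ≟ 4 * N)

    adjacent? : Decidable Adjacent
    adjacent? a b =
      ((suc a ≟ b) ⊎-dec (suc b ≟ a)) ⊎-dec
      Fin.any? (λ z → Mirror? (base z) a b) ⊎-dec
      Fin.any? (λ z → Mirror? (base z) (a + m) (b + m)) ⊎-dec Outer? a b ⊎-dec Outer? b a

    adjacent-sym : ∀ {a b} → Adjacent a b → Adjacent b a
    adjacent-sym (inj₁ s)        = inj₁ (Sum.swap s)
    adjacent-sym (inj₂ (inj₁ r)) = inj₂ (inj₁ (Match₁-sym r))
    adjacent-sym (inj₂ (inj₂ r)) = inj₂ (inj₂ (Match₂-sym r))

    -- Parity: blocks have the even length N = 2K, so their mirrors fix no point.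
    Mirror-irrefl : ∀ {L a} → ¬ Mirror L a a
    Mirror-irrefl {L} {a} (_ , _ , e) = even≢odd (L + K) a (trans (*-distribˡ-+ 2 L K)
        (trans (sym e) (cong (λ b → suc (a + b)) (sym (+-identityʳ a)))))

    Outer-irrefl : ∀ {a} → ¬ Outer a a
    Outer-irrefl {a} (_ , e) = even≢odd (2 * N) (a + m) (trans (sym (*-assoc 2 2 N))
        (trans (sym e) (cong suc
      (trans (cong (λ b → a + b + 2 * m) (sym (+-identityʳ a))) (sym (*-distribˡ-+ 2 a m))))))

    adjacent-irrefl : ∀ {a b} → a ≡ b → ¬ Adjacent a b
    adjacent-irrefl refl (inj₁ (inj₁ e)) = 1+n≢n e
    adjacent-irrefl refl (inj₁ (inj₂ e)) = 1+n≢n e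
    adjacent-irrefl {a} refl (inj₂ (inj₁ (z , r))) = Mirror-irrefl {base z} r
    adjacent-irrefl {a} refl (inj₂ (inj₂ (inj₁ (z , r)))) = Mirror-irrefl {base z} r
    adjacent-irrefl refl (inj₂ (inj₂ (inj₂ (inj₁ o)))) = Outer-irrefl o
    adjacent-irrefl refl (inj₂ (inj₂ (inj₂ (inj₂ o)))) = Outer-irrefl o

    ladders : Graph
    ladders = record
      { order    = 3 * N
      ; _~_      = λ u w → Adjacent (toℕ u) (toℕ w)
      ; _~?_     = λ u w → adjacent? (toℕ u) (toℕ w)
      ; ~-sym    = adjacent-sym
      ; ~-irrefl = λ e → adjacent-irrefl (cong toℕ e)
      }

    open Graph ladders using (Vertex)

    -- The distance is one of 1, ..., 2m - 1; one less than it is a label below k.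
    gap : ∀ {x y} → x < y → y < x + 2 * m → ∃ λ c → c < k × x + suc c ≡ y
    gap {x} {y} x<y y< with m≤n⇒∃[o]m+o≡n x<y
    ... | c , refl = c , s<s⁻¹ (subst (suc c <_) (sym suc-k) (+-cancelˡ-< x (suc c) (2 * m)
          (subst (_< x + 2 * m) (sym (+-suc x c)) y<))) , +-suc x c

    successor-inside : ∀ {i j x y} → Across i j x y → ¬ (suc x ≡ y ⊎ suc y ≡ x)
    successor-inside (i<x , x<j , inj₁ y<i) (inj₁ refl) = <-asym i<x (<-trans (n<1+n _) y<i)
    successor-inside (i<x , x<j , inj₁ y<i) (inj₂ refl) = <⇒≱ y<i (s≤s⁻¹ i<x)
    successor-inside (i<x , x<j , inj₂ j<y) (inj₁ refl) = <⇒≱ j<y x<j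
    successor-inside (i<x , x<j , inj₂ j<y) (inj₂ refl) = <-asym x<j (<-trans j<y (n<1+n _))

    module _ (D : ConvexDrawing ladders) (in-order : ∀ i → ConvexDrawing.v D i ≡ i) where
      open ConvexDrawing D

      edge : ∀ {i j} → (i , j) ∈ edges → i Fin.< j × Adjacent (toℕ i) (toℕ j)
      edge {i} {j} e∈
          with proj₂ (∈-filter⁻ _ {xs = cartesianProduct (allFin (3 * N)) (allFin (3 * N))} e∈)
      ... | i<j , adj = i<j , subst₂ (λ a b → Adjacent (toℕ a) (toℕ b)) (in-order i) (in-order j)
            adj

      Across-crossing : ∀ {i j i′ j′} → Crosses (i , j) (i′ , j′) →
                     Across (toℕ i) (toℕ j) (toℕ i′) (toℕ j′) ⊎ Across (toℕ i) (toℕ j) (toℕ j′)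
                         (toℕ i′)
      Across-crossing (inj₁ (a , b , c)) = inj₁ (a , b , inj₂ c)
      Across-crossing (inj₂ (a , b , c)) = inj₂ (b , c , inj₁ a)

      -- `M` is the matching that contains all edges crossing (i , j), and `W c` holds of the window
      -- point with label c. A label determines the point and the point its partner, so no two
      -- crossing edges share a label.
      crossings≤ : ∀ {i j} (M W : ℕ → ℕ → Set) →
        (∀ {a b} → M a b → M b a) →
        (∀ {a b b′} → b < 3 * N → b′ < 3 * N → M a b → M a b′ → b ≡ b′) →
        (∀ {c a a′} → W c a → W c a′ → a ≡ a′) →
        (∀ {x y} → x < 3 * N → y < 3 * N → Across (toℕ i) (toℕ j) x y → Adjacent x y →
          M x y × ∃ λ c → c < k × (W c x ⊎ W c y)) →
        crossings (i , j) ≤ k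
      crossings≤ {i} {j} M W M-sym M-fun W-fun locate = length≤ R
        (filter⁺ (crosses? (i , j)) {xs = edges} (filter⁺ _ (cartesianProduct⁺ (allFin⁺ _)
            (allFin⁺ _)))) label injective
        where
        R : Fin (3 * N) × Fin (3 * N) → ℕ → Set
        R (a , b) c = a Fin.< b × M (toℕ a) (toℕ b) × (W c (toℕ a) ⊎ W c (toℕ b))

        locate′ : ∀ {a b} → a Fin.< b × Adjacent (toℕ a) (toℕ b) →
                  Across (toℕ i) (toℕ j) (toℕ a) (toℕ b) ⊎ Across (toℕ i) (toℕ j) (toℕ b) (toℕ a) →
                      ∃ λ c → c < k × R (a , b) c
        locate′ {a} {b} (a<b , adj) (inj₁ across) with locate (toℕ<n a) (toℕ<n b) across adj
        ... | μ , c , c<k , w = c , c<k , a<b , μ , w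
        locate′ {a} {b} (a<b , adj) (inj₂ across)
            with locate (toℕ<n b) (toℕ<n a) across (adjacent-sym adj)
        ... | μ , c , c<k , w = c , c<k , a<b , M-sym μ , Sum.swap w

        label : ∀ {f} → f ∈ filter (crosses? (i , j)) edges → ∃ λ c → c < k × R f c
        label f∈ = locate′ (edge (proj₁ f∈E×crossing)) (Across-crossing (proj₂ f∈E×crossing))
          where f∈E×crossing = ∈-filter⁻ (crosses? (i , j)) {xs = edges} f∈

        injective : ∀ {f g c} → R f c → R g c → f ≡ g
        injective {a , b} {a′ , b′} (a<b , μ , w) (a′<b′ , μ′ , w′) = same w w′
          where
          same : _ → _ → (a , b) ≡ (a′ , b′)
          same (inj₁ w) (inj₁ w′) with refl ← toℕ-injective (W-fun w w′) =
            cong (a ,_) (toℕ-injective (M-fun (toℕ<n b) (toℕ<n b′) μ μ′))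
          same (inj₂ w) (inj₂ w′) with refl ← toℕ-injective (W-fun w w′) =
            cong (_, b) (toℕ-injective (M-fun (toℕ<n a) (toℕ<n a′) (M-sym μ) (M-sym μ′)))
          -- The window point is the smaller end of one edge and the larger end of the other; equal
          -- partners then contradict the orientation of the edges.
          same (inj₁ w) (inj₂ w′) with refl ← toℕ-injective (W-fun w w′) =
            ⊥-elim (<-asym a<b (subst (_< toℕ a) (sym (M-fun (toℕ<n b) (toℕ<n a′) μ (M-sym μ′)))
                a′<b′))
          same (inj₂ w) (inj₁ w′) with refl ← toℕ-injective (W-fun w w′) =
            ⊥-elim (<-asym a<b (subst (toℕ b <_) (sym (M-fun (toℕ<n a) (toℕ<n b′) (M-sym μ) μ′))
                a′<b′))

      few-crossings : ∀ {i j} → i Fin.< j → Adjacent (toℕ i) (toℕ j) → crossings (i , j) ≤ k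
      few-crossings {i} {j} i<j (inj₁ s) = crossings≤ (λ _ _ → ⊥) (λ _ _ → ⊥) (λ ()) (λ _ _ ())
          (λ ())
        (λ _ _ across _ → ⊥-elim (nothing-between s across))
        where
        nothing-between : ∀ {i j x y} → suc i ≡ j ⊎ suc j ≡ i → ¬ Across i j x y
        nothing-between (inj₁ refl) (i<x , x<j , _) = <⇒≱ i<x (s≤s⁻¹ x<j)
        nothing-between (inj₂ refl) (i<x , x<j , _) = <-asym (<-trans i<x x<j) (n<1+n _)
      few-crossings {i} {j} i<j (inj₂ (inj₁ μ)) = crossings≤ Match₂ (λ c x → x + suc c ≡ toℕ j)
          Match₂-sym Match₂-functional
        (λ {c} {a} {a′} e e′ → +-cancelʳ-≡ (suc c) a a′ (trans e (sym e′))) locate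
        where
        locate : ∀ {x y} → x < 3 * N → y < 3 * N → Across (toℕ i) (toℕ j) x y → Adjacent x y → _
        locate _ _ across (inj₁ s) = ⊥-elim (successor-inside across s)
        locate _ _ across (inj₂ (inj₁ ν)) = ⊥-elim (Match₁-nested μ ν across)
        locate x< y< across@(_ , x<j , _) (inj₂ (inj₂ ν)) with gap x<j (Match₁-window y< μ ν across)
        ... | c , c<k , e = ν , c , c<k , inj₁ e
      few-crossings {i} {j} i<j (inj₂ (inj₂ μ@(inj₁ (z , r)))) = crossings≤ Match₁ (λ c x →
          toℕ i + suc c ≡ x) Match₁-sym (λ _ _ → Match₁-functional)
        (λ e e′ → trans (sym e) e′) locate
        where
        locate : ∀ {x y} → x < 3 * N → y < 3 * N → Across (toℕ i) (toℕ j) x y → Adjacent x y → _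
        locate _ _ across (inj₁ s) = ⊥-elim (successor-inside across s)
        locate x< y< across (inj₂ (inj₂ ν)) = ⊥-elim (Match₂-nested i<j (toℕ<n j) x< y< μ ν across)
        locate x< y< across@(i<x , _ , _) (inj₂ (inj₁ ν))
            with gap i<x (Mirror-window {z} r ν across)
        ... | c , c<k , e = ν , c , c<k , inj₁ e
      few-crossings {i} {j} i<j (inj₂ (inj₂ μ@(inj₂ (inj₁ o)))) = crossings≤ Match₁ W Match₁-sym
          (λ _ _ → Match₁-functional) W-fun locate
        where
        -- Labels are cyclic distances from j. The bound y < 3N keeps the two alternatives from
        -- assigning one label to two points.
        W : ℕ → ℕ → Set
        W c y = y < 3 * N × (toℕ j + suc c ≡ y ⊎ toℕ j + suc c ≡ y + 3 * N)

        W-fun : ∀ {c a a′} → W c a → W c a′ → a ≡ a′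
        W-fun (_ , inj₁ e) (_ , inj₁ e′) = trans (sym e) e′
        W-fun (_ , inj₂ e) (_ , inj₂ e′) = +-cancelʳ-≡ (3 * N) _ _ (trans (sym e) e′)
        W-fun {a′ = a′} (a< , inj₁ e) (_ , inj₂ e′) =
            ⊥-elim (<⇒≱ a< (≤-trans (m≤n+m (3 * N) a′) (≤-reflexive (trans (sym e′) e))))
        W-fun {a = a} (_ , inj₂ e) (a′< , inj₁ e′) =
            ⊥-elim (<⇒≱ a′< (≤-trans (m≤n+m (3 * N) a) (≤-reflexive (trans (sym e) e′))))

        locate : ∀ {x y} → x < 3 * N → y < 3 * N → Across (toℕ i) (toℕ j) x y → Adjacent x y → _
        locate _ _ across (inj₁ s) = ⊥-elim (successor-inside across s)
        locate x< y< across (inj₂ (inj₂ ν)) = ⊥-elim (Match₂-nested i<j (toℕ<n j) x< y< μ ν across)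
        locate x< y< across (inj₂ (inj₁ ν)) with Outer-window (toℕ<n j) y< o ν across
        ... | inj₁ (lo , hi) with gap lo hi
        ...   | c , c<k , e = ν , c , c<k , inj₂ (y< , inj₁ e)
        locate x< y< across (inj₂ (inj₁ ν)) | inj₂ (lo , hi) with gap lo hi
        ...   | c , c<k , e = ν , c , c<k , inj₂ (y< , inj₂ e)
      few-crossings {i} {j} i<j (inj₂ (inj₂ (inj₂ (inj₂ o)))) = ⊥-elim (no-Outer-downwards i<j o)

      all-few-crossings : All (λ e → crossings e ≤ k) edges
      all-few-crossings = All.tabulate (λ {(i , j)} e∈ → few-crossings (proj₁ (edge e∈))
          (proj₂ (edge e∈)))

-- Ladders, lines and the bramble of order 3m

module LadderBrambles where

  open LinearArithmetic
  open Crossings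
  open Brambles
  open Counting
  open import Data.Empty using (⊥-elim)
  open import Data.Fin as Fin using (Fin; toℕ; fromℕ; inject₁; combine; remQuot; opposite)
  open import Data.Fin.Patterns
  import Data.Fin.Properties as Fin
  open import Data.Fin.Properties using (toℕ-combine; remQuot-combine; combine-remQuot;
      opposite-prop; opposite-involutive; toℕ-inject₁; toℕ-fromℕ; toℕ<n)
  open import Data.Fin.Induction using (<-weakInduction; >-weakInduction)
  open import Data.Fin.Subset using (_∈_; ∣_∣)
  open import Data.List using ([]; _∷_)
  open import Data.Nat
  open import Data.Nat.Properties
  open import Data.Product using (_×_; _,_; proj₁; proj₂; ∃; uncurry; map₂)
  open import Data.Sum as Sum using (_⊎_; inj₁; inj₂)
  open import Function using (_∘_)
  open import Relation.Binary.Construct.Closure.ReflexiveTransitive as Star using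
      (Star; ε; _◅_; _◅◅_)
  open import Relation.Binary.PropositionalEquality
  open import Relation.Nullary

  next prev : Fin 3 → Fin 3
  next 0F = 1F
  next 1F = 2F
  next 2F = 0F
  prev 0F = 2F
  prev 1F = 0F
  prev 2F = 1F

  prev-next : ∀ z → prev (next z) ≡ z
  prev-next 0F = refl
  prev-next 1F = refl
  prev-next 2F = refl

  next-compare : ∀ z z′ → z ≡ z′ ⊎ z′ ≡ next z ⊎ z ≡ next z′
  next-compare 0F 0F = inj₁ refl
  next-compare 0F 1F = inj₂ (inj₁ refl)
  next-compare 0F 2F = inj₂ (inj₂ refl)
  next-compare 1F 0F = inj₂ (inj₂ refl)
  next-compare 1F 1F = inj₁ refl
  next-compare 1F 2F = inj₂ (inj₁ refl)
  next-compare 2F 0F = inj₂ (inj₁ refl)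
  next-compare 2F 1F = inj₂ (inj₂ refl)
  next-compare 2F 2F = inj₁ refl

  toℕ-opposite : ∀ {n} (i : Fin n) → toℕ (opposite i) + suc (toℕ i) ≡ n
  toℕ-opposite i = trans (cong (_+ suc (toℕ i)) (opposite-prop i)) (m∸n+n≡m (toℕ<n i))

  module LadderBramble (m₁ k : ℕ) (suc-k : suc k ≡ 2 * suc m₁) where

    -- H is the number of columns of a ladder, chosen equal to the number 3m of lines; K is the
    -- length of half a block.
    m H K : ℕ
    m = suc m₁
    H = 3 * m
    K = H * (2 * m)

    open Ladders m K k (s≤s z≤n) suc-k
    open Graph ladders

    -- Ladder, half of the block, run of 2m consecutive points, offset in the run. Lexicographic
    -- coding makes `toℕ` the position on the circle.
    vertex : Fin 3 → Fin 2 → Fin H → Fin (2 * m) → Vertex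
    vertex z h j r = combine z (combine h (combine j r))

    lower upper : Fin 3 → Fin H → Fin (2 * m) → Vertex
    lower z = vertex z 0F
    upper z = vertex z 1F

    rows : Fin H → ℕ
    rows j = 2 * m * toℕ j

    toℕ-vertex : ∀ z h j r → toℕ (vertex z h j r) ≡ base z + (K * toℕ h + (rows j + toℕ r))
    toℕ-vertex z h j r = trans (toℕ-combine z (combine h (combine j r))) (cong (base z +_)
      (trans (toℕ-combine h (combine j r)) (cong (K * toℕ h +_) (toℕ-combine j r))))

    toℕ-lower : ∀ z j r → toℕ (lower z j r) ≡ base z + (rows j + toℕ r)
    toℕ-lower z j r = trans (toℕ-vertex z 0F j r) (cong (λ x → base z + (x + (rows j + toℕ r)))
        (*-zeroʳ K))

    toℕ-upper : ∀ z j r → toℕ (upper z j r) ≡ base z + (K + (rows j + toℕ r))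
    toℕ-upper z j r = trans (toℕ-vertex z 1F j r) (cong (λ x → base z + (x + (rows j + toℕ r)))
        (*-identityʳ K))

    rows-opposite : ∀ j → rows (opposite j) + (2 * m + rows j) ≡ K
    rows-opposite j = begin
      rows (opposite j) + (2 * m + rows j)           ≡⟨ cong (rows (opposite j) +_)
          (*-suc (2 * m) (toℕ j)) ⟨
      rows (opposite j) + 2 * m * suc (toℕ j)        ≡⟨ *-distribˡ-+ (2 * m) (toℕ (opposite j)) _ ⟨
      2 * m * (toℕ (opposite j) + suc (toℕ j))       ≡⟨ cong (2 * m *_) (toℕ-opposite j) ⟩
      2 * m * H                                        ≡⟨ *-comm (2 * m) H ⟩
      K                                                ∎
      where open ≡-Reasoning

    rows-suc : ∀ j → rows (Fin.suc j) ≡ 2 * m + rows (inject₁ j)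
    rows-suc j = trans (*-suc (2 * m) (toℕ j)) (cong (λ x → 2 * m + 2 * m * x)
        (sym (toℕ-inject₁ j)))

    last : Fin H
    last = fromℕ _

    rows-last : 2 * m + rows last ≡ K
    rows-last = trans (sym (*-suc (2 * m) (toℕ last))) (trans (cong (λ x → 2 * m * suc x)
        (toℕ-fromℕ _)) (*-comm (2 * m) H))

    Complementary : Fin (2 * m) → Fin (2 * m) → Set
    Complementary r r′ = suc (toℕ r + toℕ r′) ≡ 2 * m

    -- Mirroring a block reverses the order of the columns and the offsets within a column.
    rung : ∀ z j {r r′} → Complementary r r′ → upper z j r ~ lower z (opposite j) r′
    rung z j {r} {r′} e = inj₂ (inj₁ (z , subst₂ (Mirror (base z)) (sym (toℕ-upper z j r))
        (sym (toℕ-lower z (opposite j) r′))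
      (m≤m+n _ _ , m≤m+n _ _ , derive 7 (λ K m B J J′ r r′ →
          con 1 :+ (r :+ r′) :≡ 2 :* m ∷ J′ :+ (2 :* m :+ J) :≡ K ∷
          [] ⊢ con 1 :+ (B :+ (K :+ (J :+ r)) :+ (B :+ (J′ :+ r′))) :≡ 2 :* B :+ 2 :* K)
          K m (base z) (rows j) (rows (opposite j)) (toℕ r) (toℕ r′) e (rows-opposite j))))

    -- The rotated matching has partner sums smaller by 2m, the length of one column. Followed by a
    -- rung backwards, it moves one column outwards at the same offset.
    climb : ∀ z j {r r′} → Complementary r r′ → upper z (inject₁ j) r ~ lower z
        (opposite (Fin.suc j)) r′
    climb z j {r} {r′} e = inj₂ (inj₂ (inj₁ (z , subst₂ (λ a b → Mirror (base z) (a + m) (b + m))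
      (sym (toℕ-upper z (inject₁ j) r)) (sym (toℕ-lower z (opposite (Fin.suc j)) r′))
      (m≤n⇒m≤n+o m (m≤m+n _ _) , m≤n⇒m≤n+o m (m≤m+n _ _) ,
        derive 8 (λ K m B J J′ r r′ J₁ →
            con 1 :+ (r :+ r′) :≡ 2 :* m ∷ J′ :+ (2 :* m :+ J₁) :≡ K ∷ J₁ :≡ 2 :* m :+ J ∷
            [] ⊢ con 1 :+ (B :+ (K :+ (J :+ r)) :+ m :+ (B :+ (J′ :+ r′) :+ m)) :≡ 2 :* B :+ 2 :* K)
            K m (base z) (rows (inject₁ j)) (rows (opposite (Fin.suc j))) (toℕ r) (toℕ r′)
            (rows (Fin.suc j)) e (rows-opposite (Fin.suc j)) (rows-suc j)))))

    -- `high ρ` counts from the end of the column, at offset 2m - 1 - ρ, so that rungs exchange it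
    -- with `low ρ`.
    low high : Fin m → Fin (2 * m)
    low ρ  = combine {2} 0F ρ
    high ρ = combine {2} 1F (opposite ρ)

    toℕ-low : ∀ ρ → toℕ (low ρ) ≡ toℕ ρ
    toℕ-low ρ = trans (toℕ-combine {2} 0F ρ) (cong (_+ toℕ ρ) (*-zeroʳ m))

    toℕ-high : ∀ ρ → toℕ (high ρ) + suc (toℕ ρ) ≡ 2 * m
    toℕ-high ρ = begin
      toℕ (high ρ) + suc (toℕ ρ)               ≡⟨ cong (_+ suc (toℕ ρ)) (toℕ-combine {2} 1F
          (opposite ρ)) ⟩
      m * 1 + toℕ (opposite ρ) + suc (toℕ ρ)   ≡⟨ +-assoc (m * 1) _ _ ⟩
      m * 1 + (toℕ (opposite ρ) + suc (toℕ ρ)) ≡⟨ cong (m * 1 +_) (toℕ-opposite ρ) ⟩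
      m * 1 + m                                  ≡⟨ cong (_+ m) (*-identityʳ m) ⟩
      m + m                                      ≡⟨ cong (m +_) (+-identityʳ m) ⟨
      2 * m                                      ∎
      where open ≡-Reasoning

    low-high : ∀ ρ → Complementary (low ρ) (high ρ)
    low-high ρ = trans (cong (λ x → suc (x + toℕ (high ρ))) (toℕ-low ρ))
        (trans (+-comm (suc (toℕ ρ)) (toℕ (high ρ))) (toℕ-high ρ))

    high-low : ∀ ρ → Complementary (high ρ) (low ρ)
    high-low ρ = trans (cong suc (+-comm (toℕ (high ρ)) (toℕ (low ρ)))) (low-high ρ)

    base-next : ∀ z → base (next z) ≡ base z + N ⊎ (base z ≡ 2 * N × base (next z) ≡ 0)
    base-next 0F = inj₁ (trans (*-identityʳ N) (cong (_+ N) (sym (*-zeroʳ N))))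
    base-next 1F = inj₁ (trans (*-suc N 1) (+-comm N (N * 1)))
    base-next 2F = inj₂ (*-comm N 2 , *-zeroʳ N)

    -- The last m points of block z open the rotated block of the next ladder. Their partners are
    -- the last m points of that rotated block, which form the low half of the last column.
    junction : ∀ z ρ → upper z last (high ρ) ~ upper (next z) last (low ρ)
    junction z ρ = inj₂ (inj₂ (subst₂ Match₂ (sym (toℕ-upper z last (high ρ)))
        (sym (toℕ-upper (next z) last (low ρ))) matched))
      where
      B = base z
      B′ = base (next z)
      matched : Match₂ (B + (K + (rows last + toℕ (high ρ)))) (B′ + (K + (rows last + toℕ (low ρ))))
      matched with base-next z
      ... | inj₁ e = inj₁ (next z ,
              derive 8 (λ K m B B′ J r ρ ρ′ →
                  B′ :≡ B :+ 2 :* K ∷ 2 :* m :+ J :≡ K ∷ r :+ (con 1 :+ ρ) :≡ 2 :* m ∷ ρ :< m ∷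
                  [] ⊢ B′ :≤ B :+ (K :+ (J :+ r)) :+ m)
                  K m B B′ (rows last) (toℕ (high ρ)) (toℕ ρ) (toℕ (low ρ)) e rows-last (toℕ-high ρ)
                  (toℕ<n ρ) ,
              m≤n⇒m≤n+o m (m≤m+n _ _) ,
                derive 8 (λ K m B B′ J r ρ ρ′ →
                    B′ :≡ B :+ 2 :* K ∷ 2 :* m :+ J :≡ K ∷ r :+ (con 1 :+ ρ) :≡ 2 :* m ∷ ρ′ :≡ ρ ∷
                    []
                    ⊢ con 1 :+ (B :+ (K :+ (J :+ r)) :+ m :+ (B′ :+ (K :+ (J :+ ρ′)) :+ m)) :≡ 2 :*
                    B′ :+ 2 :* K)
                    K m B B′ (rows last) (toℕ (high ρ)) (toℕ ρ) (toℕ (low ρ)) e rows-last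
                    (toℕ-high ρ) (toℕ-low ρ))
      -- From ladder 2 to ladder 0 the rotated block wraps around. The vertex of ladder 2 is the end
      -- near 3N, the second argument of `Outer`.
      ... | inj₂ (e , e′) = inj₂ (inj₂ (
              derive 6 (λ K m B J r ρ →
                  B :≡ 2 :* (2 :* K) ∷ 2 :* m :+ J :≡ K ∷ r :+ (con 1 :+ ρ) :≡ 2 :* m ∷ ρ :< m ∷
                  [] ⊢ 3 :* (2 :* K) :≤ B :+ (K :+ (J :+ r)) :+ m)
                  K m B (rows last) (toℕ (high ρ)) (toℕ ρ) e rows-last (toℕ-high ρ) (toℕ<n ρ) ,
              derive 8 (λ K m B B′ J r ρ ρ′ →
                  B :≡ 2 :* (2 :* K) ∷ B′ :≡ con 0 ∷ 2 :* m :+ J :≡ K ∷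
                  r :+ (con 1 :+ ρ) :≡ 2 :* m ∷ ρ′ :≡ ρ ∷
                  []
                  ⊢ con 1 :+ (B′ :+ (K :+ (J :+ ρ′)) :+ (B :+ (K :+ (J :+ r))) :+ 2 :* m) :≡ 4 :*
                  (2 :* K))
                  K m B B′ (rows last) (toℕ (high ρ)) (toℕ ρ) (toℕ (low ρ)) e e′ rows-last
                  (toℕ-high ρ) (toℕ-low ρ)))

    column-edge : ∀ z j {r r′} → suc (toℕ r) ≡ toℕ r′ → upper z j r ~ upper z j r′
    column-edge z j {r} {r′} e = inj₁ (inj₁ (trans (cong suc (toℕ-upper z j r)) (trans
      (derive 5 (λ B K J r r′ →
          con 1 :+ r :≡ r′ ∷ [] ⊢ con 1 :+ (B :+ (K :+ (J :+ r))) :≡ B :+ (K :+ (J :+ r′)))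
          (base z) K (rows j) (toℕ r) (toℕ r′) e)
      (sym (toℕ-upper z j r′)))))

    -- The connected sets of the bramble: a line together with a column of the
    -- ladder in which the line starts.
    data Element (z : Fin 3) (ρ : Fin m) (c : Fin H) : Vertex → Set where
      column       : ∀ r → Element z ρ c (upper z c r)
      start-upper  : ∀ j → Element z ρ c (upper z j (high ρ))
      start-lower  : ∀ j → Element z ρ c (lower z (opposite j) (low ρ))
      finish-upper : ∀ j → Element z ρ c (upper (next z) j (low ρ))
      finish-lower : ∀ j → Element z ρ c (lower (next z) (opposite j) (high ρ))

    Within : (Vertex → Set) → Vertex → Vertex → Set
    Within P a b = a ~ b × P a × P b

    Within-sym : ∀ {P a b} → Within P a b → Within P b a
    Within-sym {a = a} {b} (r , p , q) = ~-sym {a} {b} r , q , p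

    module _ {P : Vertex → Set} (z : Fin 3) where

      along-line : ∀ {r r′} → Complementary r r′ → (∀ j → P (upper z j r)) →
          (∀ j → P (lower z (opposite j) r′)) →
                   ∀ j → Star (Within P) (upper z j r) (upper z last r)
      along-line {r} {r′} e pu pl = >-weakInduction (λ j → Star (Within P) (upper z j r)
          (upper z last r)) ε
        (λ j w → (climb z j e , pu (inject₁ j) , pl (Fin.suc j)) ◅
                 Within-sym {P} {upper z (Fin.suc j) r} {lower z (opposite (Fin.suc j)) r′}
                     (rung z (Fin.suc j) e , pu (Fin.suc j) , pl (Fin.suc j)) ◅ w)

      rung-to-line : ∀ {r r′} → Complementary r r′ → (∀ j → P (upper z j r)) →
          (∀ j → P (lower z (opposite j) r′)) →
                     ∀ j → Star (Within P) (lower z (opposite j) r′) (upper z last r)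
      rung-to-line {r} {r′} e pu pl j =
        Within-sym {P} {upper z j r} {lower z (opposite j) r′} (rung z j e , pu j , pl j) ◅
            along-line e pu pl j

      along-column : ∀ c → (∀ r → P (upper z c r)) → ∀ r r′ → Star (Within P) (upper z c r)
          (upper z c r′)
      along-column c p r r′ = Star.reverse (λ {a} {b} → Within-sym {P} {a} {b}) (from-bottom r) ◅◅
          from-bottom r′
        where
        from-bottom : ∀ r → Star (Within P) (upper z c 0F) (upper z c r)
        from-bottom = <-weakInduction (λ r → Star (Within P) (upper z c 0F) (upper z c r)) ε
          (λ r w → w ◅◅ (column-edge z c (cong suc (toℕ-inject₁ r)) , p (inject₁ r) , p (Fin.suc r))
              ◅ ε)

    module _ (z : Fin 3) (ρ : Fin m) (c : Fin H) where

      -- The vertex where the line leaves ladder z.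
      hub : Vertex
      hub = upper z last (high ρ)

      to-hub : ∀ {x} → Element z ρ c x → Star (Within (Element z ρ c)) x hub
      to-hub (column r)       = along-column z c column r (high ρ) ◅◅ to-hub (start-upper c)
      to-hub (start-upper j)  = along-line z (high-low ρ) start-upper start-lower j
      to-hub (start-lower j)  = rung-to-line z (high-low ρ) start-upper start-lower j
      to-hub (finish-upper j) = along-line (next z) (low-high ρ) finish-upper finish-lower j ◅◅
        Within-sym {Element z ρ c} {hub} {upper (next z) last (low ρ)} (junction z ρ ,
            start-upper last , finish-upper last) ◅ ε
      to-hub (finish-lower j) = rung-to-line (next z) (low-high ρ) finish-upper finish-lower j ◅◅
          to-hub (finish-upper last)

      Element-connected : ∀ {x y} → Element z ρ c x → Element z ρ c y →
          Star (Within (Element z ρ c)) x y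
      Element-connected p q = to-hub p ◅◅ Star.reverse (λ {a} {b} →
          Within-sym {Element z ρ c} {a} {b}) (to-hub q)

    -- In equal ladders the line of the second element starts across the column of the first. In
    -- consecutive ladders the line that starts in the former finishes across the column in the
    -- latter.
    Elements-meet : ∀ z ρ c z′ ρ′ c′ → ∃ λ x → Element z ρ c x × Element z′ ρ′ c′ x
    Elements-meet z ρ c z′ ρ′ c′ with next-compare z z′
    ... | inj₁ refl        = upper z c (high ρ′) , column (high ρ′) , start-upper c
    ... | inj₂ (inj₁ refl) = upper z′ c′ (low ρ) , finish-upper c′ , column (low ρ)
    ... | inj₂ (inj₂ refl) = upper z c (low ρ′) , column (low ρ′) , finish-upper c

    -- The line through a vertex. In the upper half, high offsets belong to lines that start in z
    -- and low offsets to lines that arrive from `prev z`; rungs reverse offsets, so the lower half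
    -- is the other way round.
    strand : Fin 3 → Fin 2 → Fin 2 × Fin m → Fin 3 × Fin m
    strand z 1F (1F , σ) = z , opposite σ
    strand z 0F (0F , σ) = z , σ
    strand z 1F (0F , σ) = prev z , σ
    strand z 0F (1F , σ) = prev z , opposite σ

    coordinates : Vertex → Fin 3 × Fin 2 × Fin H × Fin (2 * m)
    coordinates x = map₂ (λ s → map₂ (remQuot {H} (2 * m)) (remQuot {2} K s)) (remQuot {3} N x)

    coordinates-vertex : ∀ z h j r → coordinates (vertex z h j r) ≡ (z , h , j , r)
    coordinates-vertex z h j r =
      trans (cong (map₂ (λ s → map₂ (remQuot {H} (2 * m)) (remQuot {2} K s))) (remQuot-combine {3} z
          (combine h (combine j r)))) (cong (z ,_)
      (trans (cong (map₂ (remQuot {H} (2 * m))) (remQuot-combine {2} h (combine j r))) (cong (h ,_)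
      (remQuot-combine {H} j r))))

    line : Vertex → Fin 3 × Fin m
    line x = (λ (z , h , _ , r) → strand z h (remQuot {2} m r)) (coordinates x)

    -- Only relevant on the upper halves of ladders, whose columns these are.
    columnOf : Vertex → Fin H
    columnOf x = proj₁ (proj₂ (proj₂ (coordinates x)))

    line-vertex : ∀ z h j s σ → line (vertex z h j (combine {2} s σ)) ≡ strand z h (s , σ)
    line-vertex z h j s σ =
      trans (cong (λ (z , h , _ , r) → strand z h (remQuot {2} m r)) (coordinates-vertex z h j
          (combine {2} s σ)))
            (cong (strand z h) (remQuot-combine {2} s σ))

    Element-labels : ∀ {z ρ c x} → Element z ρ c x → line x ≡ (z , ρ) ⊎ columnOf x ≡ c
    Element-labels {z} {ρ} {c} (column r) =
        inj₂ (cong (proj₁ ∘ proj₂ ∘ proj₂) (coordinates-vertex z 1F c r))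
    Element-labels {z} {ρ} (start-upper j) = inj₁ (trans (line-vertex z 1F j 1F (opposite ρ))
        (cong (z ,_) (opposite-involutive ρ)))
    Element-labels {z} {ρ} (start-lower j) = inj₁ (line-vertex z 0F (opposite j) 0F ρ)
    Element-labels {z} {ρ} (finish-upper j) = inj₁ (trans (line-vertex (next z) 1F j 0F ρ)
        (cong (_, ρ) (prev-next z)))
    Element-labels {z} {ρ} (finish-lower j) =
        inj₁ (trans (line-vertex (next z) 0F (opposite j) 1F (opposite ρ)) (cong₂ _,_ (prev-next z)
        (opposite-involutive ρ)))

    module _ (D : TreeDecomposition ladders) where
      open TreeDecomposition D

      large-bag : ∃ λ t → 3 * m ≤ ∣ bag t ∣
      large-bag with Fin.any? (λ t → 3 * m ≤? ∣ bag t ∣)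
      ... | yes found = found
      ... | no  small = ⊥-elim (bramble-covered D {Fin 3 × Fin m × Fin H} (λ (z , ρ , c) →
            Element z ρ c)
              (λ (z , ρ , c) → Element-connected z ρ c) (λ (z , ρ , c) (z′ , ρ′ , c′) →
                  Elements-meet z ρ c z′ ρ′ c′) avoided)
        where
        avoided : ∀ t → ∃ λ i → ∀ {x} → x ∈ bag t → ¬ Element (proj₁ i) (proj₁ (proj₂ i))
            (proj₂ (proj₂ i)) x
        -- There are 3m lines and H = 3m column indices, so a bag with fewer than 3m vertices misses
        -- one of each, and hence the element made of these two.
        avoided t with missed-label (bag t) (uncurry combine ∘ line) (≰⇒> (λ big → small (t , big)))
                     | missed-label (bag t) columnOf (≰⇒> (λ big → small (t , big)))
        ... | ℓ , ℓ-missed | c , c-missed = (proj₁ (remQuot {3} m ℓ) , proj₂ (remQuot {3} m ℓ) ,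
              c) ,
          λ x∈ el → Sum.[ (λ e → ℓ-missed x∈ (trans (cong (uncurry combine) e)
              (combine-remQuot {3} m ℓ))) , c-missed x∈ ] (Element-labels el)

-- The bound for odd k

open Geometry using (drawing; no-triple-crossing)
open Counting
open LadderBrambles
open import Data.Fin.Subset using (∣_∣)
open import Data.Integer as ℤ using (+_)
import Data.Integer.Properties as ℤ
open import Data.List using (tabulate)
open import Data.List.Extrema.Nat using (xs≤max)
open import Data.List.Membership.Propositional.Properties using (∈-tabulate⁺)
import Data.List.Relation.Unary.All as All
open import Data.Nat as ℕ using (ℕ; _<_; _%_; suc)
open import Data.Nat.DivMod using (m≡m%n+[m/n]*n)
import Data.Nat.Properties as ℕ
open import Data.Nat.Tactic.RingSolver using (solve-∀)
open import Data.Product using (∃; _×_; _,_)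
open import Data.Rational as ℚ using (_/_; _+_; _*_; ½; _≤_; toℚᵘ)
import Data.Rational.Properties as ℚ
open import Data.Rational.Unnormalised as ℚᵘ using (mkℚᵘ)
import Data.Rational.Unnormalised.Properties as ℚᵘ
open import Relation.Binary.PropositionalEquality

-- For k = 2q + 1 the bound equals 3 (q + 1) - 1, and o is the excess of the largest bag over 3m.
-- Unnormalised fractions reduce the claim to an inequality of numerators.
bound≤width : ∀ q o → (+ 3 / 2) * (+ (1 ℕ.+ q ℕ.* 2) / 1) + ½ ≤ (3 ℕ.* suc q ℕ.+ o ℤ.⊖ 1) / 1
bound≤width q o = ℚ.toℚᵘ-cancel-≤ (begin
  toℚᵘ ((+ 3 / 2) * (+ k / 1) + ½)        ≃⟨ ℚ.toℚᵘ-homo-+ ((+ 3 / 2) * (+ k / 1)) ½ ⟩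
  toℚᵘ ((+ 3 / 2) * (+ k / 1)) ℚᵘ.+ ℚᵘ.½  ≃⟨ ℚᵘ.+-congˡ ℚᵘ.½ (ℚ.toℚᵘ-homo-* (+ 3 / 2) (+ k / 1)) ⟩
  mkℚᵘ (+ 3) 1 ℚᵘ.* toℚᵘ (+ k / 1) ℚᵘ.+ ℚᵘ.½
    ≃⟨ ℚᵘ.+-congˡ ℚᵘ.½ (ℚᵘ.*-congˡ {mkℚᵘ (+ 3) 1} (ℚ.toℚᵘ-fromℚᵘ (mkℚᵘ (+ k) 0))) ⟩
  mkℚᵘ (+ 3) 1 ℚᵘ.* mkℚᵘ (+ k) 0 ℚᵘ.+ ℚᵘ.½ ≤⟨ ℚᵘ.*≤*
      (ℤ.≤-trans (ℤ.+≤+ (ℕ.≤-trans (ℕ.≤-trans (ℕ.≤-reflexive (ℕ.+-comm 2 _)) (ℕ.m≤m+n _ (o ℕ.* 4)))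
      (ℕ.≤-reflexive (numerators q o)))) (ℤ.≤-reflexive (ℤ.pos-* (q ℕ.+ 2 ℕ.* suc q ℕ.+ o) 4))) ⟩
  mkℚᵘ (3 ℕ.* suc q ℕ.+ o ℤ.⊖ 1) 0          ≃⟨ ℚ.toℚᵘ-fromℚᵘ (mkℚᵘ (3 ℕ.* suc q ℕ.+ o ℤ.⊖ 1) 0) ⟨
  toℚᵘ ((3 ℕ.* suc q ℕ.+ o ℤ.⊖ 1) / 1)    ∎)
  where
  open ℚᵘ.≤-Reasoning
  k = 1 ℕ.+ q ℕ.* 2

  numerators : ∀ q o → ((q ℕ.* 2 ℕ.+ 2 ℕ.* suc (q ℕ.* 2)) ℕ.* 2 ℕ.+ 2) ℕ.* 1 ℕ.+ 2 ℕ.+ o ℕ.* 4 ≡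
      (q ℕ.+ 2 ℕ.* suc q ℕ.+ o) ℕ.* 4
  numerators = solve-∀

theorem7 : (k : ℕ) → 0 < k → k % 2 ≡ 1 →
    ∃ λ (G : Graph) → OuterPlanar k G × ((+ 3 / 2) * (+ k / 1) + ½) ≤tw G
theorem7 k 0<k odd with k ℕ./ 2 | trans (m≡m%n+[m/n]*n k 2) (cong (ℕ._+ (k ℕ./ 2) ℕ.* 2) odd)
... | q | refl = G , (drawing G , planar) , wide
  where
  suc-k : suc (1 ℕ.+ q ℕ.* 2) ≡ 2 ℕ.* suc q
  suc-k = ℕ.*-comm (suc q) 2
  module L = LadderBramble q (1 ℕ.+ q ℕ.* 2) suc-k
  module B = Ladders (suc q) L.K (1 ℕ.+ q ℕ.* 2) (ℕ.s≤s ℕ.z≤n) suc-k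
  G = B.ladders

  planar : IsOuterPlanarDrawing k (drawing G)
  planar = record
    { noTripleCrossing = no-triple-crossing G
    ; fewCrossings     = B.all-few-crossings (drawing G) (λ _ → refl)
    }

  wide : ((+ 3 / 2) * (+ k / 1) + ½) ≤tw G
  wide D with L.large-bag D
  ... | t , large
        with ℕ.m≤n⇒∃[o]m+o≡n (ℕ.≤-trans large (All.lookup (xs≤max 0 sizes) (∈-tabulate⁺ t)))
    where sizes = tabulate (λ t → ∣ TreeDecomposition.bag D t ∣)
  ...   | o , e = subst (λ M → (+ 3 / 2) * (+ k / 1) + ½ ≤ (M ℤ.⊖ 1) / 1) e (bound≤width q o)
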